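{- For every integer $d\ge 0$, $$H_d = \sum_{\delta \in \mathrm{PCom}_{\mathrm{sqf}}(d)} \frac{P_\delta}{Z_\delta}.$$
   Context: A composition of $n\ge 0$ is a finite tuple $\alpha=(\alpha_1,\dots,\alpha_l)$ of positive integers with sum $n$; the empty composition is the only composition of $0$. A polycomposition of $n$ is a sequence $\delta=(\alpha^{(1)},\alpha^{(2)},\dots)$ of (possibly empty) compositions with $\sum_{i\ge1} i|\alpha^{(i)}|=n$; write formally (not exponentiation) $\delta=(\alpha^{(1)})^1(\alpha^{(2)})^2\cdots$, omitting empty compositions. Each part $d$ of $\alpha^{(r)}$ gives a block $d^r$ of $\delta$. $\mathrm{PCom}_{\mathrm{sqf}}(d)$ is the set of square-free polycompositions of $d$: those of the form $(\alpha)^1$ with $\alpha$ a composition of $d$. For a composition $\alpha=(\alpha_1,\dots,\alpha_l)$ put $Z_\alpha=\alpha_1(\alpha_1+\alpha_2)(\alpha_1+\alpha_2+\alpha_3)\cdots(\alpha_1+\cdots+\alpha_l)$ (equal to $1$ for the empty composition), and for $\delta=(\alpha)^1$ put $Z_\delta=Z_\alpha$. Let $x_{i,j}$ ($i,j\ge 1$) be indeterminates with $\deg x_{i,j}=i$; all series have rational coefficients. $H_d$ is the sum of all monomials of degree $d$ (so $H_0=1$). For $d\ge1$, $P_d=\sum_{k\mid d}\sum_{j\ge1} k\,x_{k,j}^{d/k}$, with $k$ ranging over positive divisors of $d$. For a block $d^r$, $P_{d^r}$ is obtained from $P_d$ by replacing each $x_{i,j}$ by $x_{i,j}^r$, and $P_\delta=\prod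 P_{d^r}$ over all blocks $d^r$ of $\delta$ (counted with repetition; empty product $=1$). -}

module Defs where

open import Data.Bool using (if_then_else_)
open import Data.Integer using (+_)
open import Data.List using (List; []; _∷_; [_]; _++_; map; concatMap; foldr; length; replicate; upTo; filter; cartesianProductWith)
open import Data.List.Membership.Propositional using (_∈_; lose)
open import Data.List.Membership.Propositional.Properties using (∈-concatMap⁺; ∈-concatMap⁻; ∈-map⁺; ∈-map⁻)
open import Data.List.Relation.Unary.All as All using (All; []; _∷_; all?)
import Data.List.Relation.Unary.All.Properties as Allₚ
open import Data.List.Relation.Unary.AllPairs as AllPairs using ([]; _∷_)
import Data.List.Relation.Unary.AllPairs.Properties as AllPairsₚ
open import Data.List.Relation.Unary.Any using (Any; here; there)
open import Data.List.Relation.Unary.Unique.Propositional using (Unique)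
import Data.List.Relation.Unary.Unique.Propositional.Properties as Uniqueₚ
open import Data.Nat using (ℕ; zero; suc; _+_; _*_; _∸_; _⊔_; _≤_; z≤n; s≤s; _≟_; NonZero)
open import Data.Nat.Divisibility using (_∣?_)
open import Data.Nat.DivMod using (_/_)
open import Data.Nat.ListAction using (sum)
open import Data.Nat.Properties using (nonZero?; m*n≢0; +-identityʳ; suc-injective; m⊔n≤o⇒m≤o; m⊔n≤o⇒n≤o)
open import Data.Product using (Σ-syntax; ∃; _×_; _,_; proj₁; proj₂)
open import Data.Rational as ℚ using (ℚ; 0ℚ; 1ℚ)
open import Function using (_∘_)
open import Relation.Binary.Definitions using (Decidable)
open import Relation.Binary.PropositionalEquality using (_≡_; _≢_; refl; sym; trans; cong)
open import Relation.Nullary using (Dec; yes; no; does; map′; _×-dec_; ¬_)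
open import Relation.Nullary.Decidable using (dec-false; recompute)

-- A list (y₁ , … , yₛ) stands for a sequence indexed from 1;  index-sum f
-- is  1 · f y₁ + 2 · f y₂ + … + s · f yₛ.
index-sum-from : {A : Set} → ℕ → (A → ℕ) → List A → ℕ
index-sum-from i f []       = 0
index-sum-from i f (y ∷ ys) = i * f y + index-sum-from (suc i) f ys

index-sum : {A : Set} → (A → ℕ) → List A → ℕ
index-sum = index-sum-from 1

nth : {A : Set} → A → List A → ℕ → A
nth d []       _       = d
nth d (y ∷ _)  zero    = y
nth d (_ ∷ ys) (suc i) = nth d ys i

nth-pointwise? : {A : Set} {R : A → A → Set} → Decidable R → (d : A) →
                 (xs ys : List A) → R d d → Dec (∀ i → R (nth d xs i) (nth d ys i))
nth-pointwise? {R = R} R? d = go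
  where
  split : ∀ {P : ℕ → Set} → Dec (P 0) → Dec (∀ i → P (suc i)) → Dec (∀ i → P i)
  split p q = map′ (λ { (a , f) zero → a ; (a , f) (suc i) → f i })
                   (λ f → f 0 , f ∘ suc) (p ×-dec q)
  go : ∀ xs ys → R d d → Dec (∀ i → R (nth d xs i) (nth d ys i))
  go []       []       r = yes (λ _ → r)
  go []       (y ∷ ys) r = split (R? d y) (go [] ys r)
  go (x ∷ xs) []       r = split (R? x d) (go xs [] r)
  go (x ∷ xs) (y ∷ ys) r = split (R? x y) (go xs ys r)

------------------------------------------------------------------------
-- Monomials in the indeterminates x_{i,j}

-- The j-th entry of the i-th row (both counted from 0) is the exponent of
-- x_{i+1,j+1}; exponents outside the table are 0.  So a monomial has many
-- tables (differing by zero padding), identified by _≈ₘ_.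
Monomial : Set
Monomial = List (List ℕ)

exponent : Monomial → ℕ → ℕ → ℕ
exponent m i j = nth 0 (nth [] m i) j

infix 4 _≈ₘ_ _≈ₘ?_

_≈ₘ_ : Monomial → Monomial → Set
m ≈ₘ m′ = ∀ i j → exponent m i j ≡ exponent m′ i j

_≈ₘ?_ : Decidable _≈ₘ_
m ≈ₘ? m′ = nth-pointwise? (λ r r′ → nth-pointwise? _≟_ 0 r r′ refl) [] m m′ (λ _ → refl)

degree : Monomial → ℕ
degree = index-sum sum

-- Indices are shifted:  x (i , j) ^ₘ e  is  x_{i+1,j+1}ᵉ.
x_^ₘ_ : ℕ × ℕ → ℕ → Monomial
x (i , j) ^ₘ e = replicate i [] ++ [ replicate j 0 ++ [ e ] ]

splits : ℕ → List (ℕ × ℕ)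
splits n = map (λ k → k , n ∸ k) (upTo (suc n))

splits* : {A : Set} → (A → List (A × A)) → List A → List (List A × List A)
splits* s []       = [ [] , [] ]
splits* s (y ∷ ys) =
  cartesianProductWith (λ { (a , b) (as , bs) → a ∷ as , b ∷ bs }) (s y) (splits* s ys)

-- All pairs of monomials whose product is the given one, each listed once
-- (as tables of the same shape).
factorizations : Monomial → List (Monomial × Monomial)
factorizations = splits* (splits* splits)

------------------------------------------------------------------------
-- Formal power series over ℚ

-- A series is its coefficient function.  All series built below give
-- ≈ₘ-equal tables the same coefficient.
Series : Set
Series = Monomial → ℚ

infix 4 _≈_
_≈_ : Series → Series → Set
F ≈ G = ∀ m → F m ≡ G m

sumℚ : List ℚ → ℚ
sumℚ = foldr ℚ._+_ 0ℚ

ℕ→ℚ : ℕ → ℚ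
ℕ→ℚ n = + n ℚ./ 1

infixl 7 _⊛_ _÷_
infixr 8 _·_

∑ : {A : Set} → List A → (A → Series) → Series
∑ as F m = sumℚ (map (λ a → F a m) as)

_⊛_ : Series → Series → Series
(F ⊛ G) m = sumℚ (map (λ { (a , b) → F a ℚ.* G b }) (factorizations m))

⟦_⟧ : Monomial → Series
⟦ u ⟧ m = if does (m ≈ₘ? u) then 1ℚ else 0ℚ

𝟙 : Series
𝟙 = ⟦ [] ⟧

∏ : List Series → Series
∏ = foldr _⊛_ 𝟙

_·_ : ℕ → Series → Series
(n · F) m = ℕ→ℚ n ℚ.* F m

_÷_ : Series → (n : ℕ) → .{{NonZero n}} → Series
(F ÷ n) m = F m ℚ.* (+ 1 ℚ./ n)

-- Replace every indeterminate by its r-th power.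
_[x^_] : Series → (r : ℕ) → .{{NonZero r}} → Series
(F [x^ r ]) m =
  if does (all? (all? (r ∣?_)) m) then F (map (map (_/ r)) m) else 0ℚ

width : Monomial → ℕ
width m = foldr _⊔_ 0 (map length m)

-- The infinite sum  Σ_{j ≥ 1} x_{i+1,j}ᵉ  for e ≥ 1.  At a monomial m only
-- the terms with j ≤ width m can contribute, by beyond-width.
∑ⱼx_^_ : ℕ → ℕ → Series
(∑ⱼx i ^ e) m = ∑ (upTo (width m)) (λ j → ⟦ x (i , j) ^ₘ e ⟧) m

nth-beyond : (r : List ℕ) {j : ℕ} → length r ≤ j → nth 0 r j ≡ 0
nth-beyond []      _         = refl
nth-beyond (_ ∷ r) (s≤s l≤j) = nth-beyond r l≤j

exponent-beyond : ∀ m i {j} → width m ≤ j → exponent m i j ≡ 0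
exponent-beyond []      i       _ = refl
exponent-beyond (r ∷ m) zero    w = nth-beyond r (m⊔n≤o⇒m≤o (length r) _ w)
exponent-beyond (r ∷ m) (suc i) w = exponent-beyond m i (m⊔n≤o⇒n≤o (length r) _ w)

exponent-x : ∀ i j e → exponent (x (i , j) ^ₘ e) i j ≡ e
exponent-x zero    zero    e = refl
exponent-x zero    (suc j) e = exponent-x zero j e
exponent-x (suc i) j       e = exponent-x i j e

beyond-width : ∀ m i {j} e → width m ≤ j → ⟦ x (i , j) ^ₘ suc e ⟧ m ≡ 0ℚ
beyond-width m i {j} e w = cong (if_then 1ℚ else 0ℚ) (dec-false (m ≈ₘ? _) differ)
  where
  differ : ¬ (m ≈ₘ x (i , j) ^ₘ suc e)
  differ eq with trans (sym (exponent-beyond m i w)) (trans (eq i j) (exponent-x i j (suc e)))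
  ... | ()

H : ℕ → Series
H d m = if does (degree m ≟ d) then 1ℚ else 0ℚ

-- The divisor k is suc i.  (Used only for d ≥ 1; P 0 is the zero series.)
P : ℕ → Series
P d = ∑ (filter (λ i → suc i ∣? d) (upTo d)) (λ i → suc i · (∑ⱼx i ^ (d / suc i)))

------------------------------------------------------------------------
-- Compositions

record Composition : Set where
  constructor comp
  field
    parts     : List ℕ
    .positive : All NonZero parts

open Composition public

∣_∣ᶜ : Composition → ℕ
∣ α ∣ᶜ = sum (parts α)

-- Product of the partial sums of a list, each increased by s.
partial-sum-product : ℕ → List ℕ → ℕ
partial-sum-product s []      = 1
partial-sum-product s (a ∷ α) = (s + a) * partial-sum-product (s + a) α

-- For eliminating irrelevant positivity proofs.
recover : ∀ {α} → .(All NonZero α) → All NonZero α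
recover {α} ps = recompute (all? nonZero? α) ps

partial-sum-product≢0 : ∀ s α → All NonZero α → NonZero (partial-sum-product s α)
partial-sum-product≢0 s []          _        = _
partial-sum-product≢0 s (suc a ∷ α) (_ ∷ ps) =
  m*n≢0 (s + suc a) _ {{s+suc≢0 s}} {{partial-sum-product≢0 (s + suc a) α ps}}
  where
  s+suc≢0 : ∀ t → NonZero (t + suc a)
  s+suc≢0 zero    = _
  s+suc≢0 (suc t) = _

Zᶜ : Composition → ℕ
Zᶜ α = partial-sum-product 0 (parts α)

-- Compositions of n + 1 from those of n: prepend a part 1, or increase the
-- first part by 1.
grow : Composition → List Composition
grow (comp []      _)  = [ comp [ 1 ] (_ ∷ []) ]
grow (comp (a ∷ α) ps) = comp (1 ∷ a ∷ α) (_ ∷ ps) ∷ comp (suc a ∷ α) (_ ∷ All.tail ps) ∷ []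

compositions : ℕ → List Composition
compositions zero    = [ comp [] [] ]
compositions (suc n) = concatMap grow (compositions n)

compositions-complete : ∀ n α → ∣ α ∣ᶜ ≡ n → α ∈ compositions n
compositions-complete zero    (comp [] _)                 _  = here refl
compositions-complete _       (comp (zero ∷ _) ps)        _ with recover ps
... | () ∷ _
compositions-complete (suc n) (comp (suc zero ∷ []) ps)   eq =
  ∈-concatMap⁺ grow (lose (compositions-complete n (comp [] []) (suc-injective eq)) (here refl))
compositions-complete (suc n) (comp (suc zero ∷ b ∷ α) ps) eq =
  ∈-concatMap⁺ grow
    (lose (compositions-complete n (comp (b ∷ α) (All.tail ps)) (suc-injective eq)) (here refl))
compositions-complete (suc n) (comp (suc (suc a) ∷ α) ps) eq =
  ∈-concatMap⁺ grow
    (lose (compositions-complete n (comp (suc a ∷ α) (_ ∷ All.tail ps)) (suc-injective eq))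
          (there (here refl)))

grow-size : ∀ α {β} → β ∈ grow α → ∣ β ∣ᶜ ≡ suc ∣ α ∣ᶜ
grow-size (comp []      _) (here refl)         = refl
grow-size (comp (_ ∷ _) _) (here refl)         = refl
grow-size (comp (_ ∷ _) _) (there (here refl)) = refl

compositions-sound : ∀ n {α} → α ∈ compositions n → ∣ α ∣ᶜ ≡ n
compositions-sound zero    (here refl) = refl
compositions-sound (suc n) α∈ = go (compositions n) (compositions-sound n) (∈-concatMap⁻ grow α∈)
  where
  go : ∀ βs → (∀ {β} → β ∈ βs → ∣ β ∣ᶜ ≡ n) → ∀ {α} → Any (λ β → α ∈ grow β) βs → ∣ α ∣ᶜ ≡ suc n
  go (β ∷ _)  h (here p)  = trans (grow-size β p) (cong suc (h (here refl)))
  go (_ ∷ βs) h (there p) = go βs (h ∘ there) p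

-- Parts of the composition that grow started from.
shrink : List ℕ → List ℕ
shrink []                = []
shrink (zero ∷ α)        = α
shrink (suc zero ∷ α)    = α
shrink (suc (suc a) ∷ α) = suc a ∷ α

shrink-grow : ∀ α {β} → β ∈ grow α → shrink (parts β) ≡ parts α
shrink-grow (comp []          _) (here refl)         = refl
shrink-grow (comp (_ ∷ _)     _) (here refl)         = refl
shrink-grow (comp (suc _ ∷ _) _) (there (here refl)) = refl
shrink-grow (comp (zero ∷ _) ps) (there (here refl)) with recover ps
... | () ∷ _

grow-unique : ∀ α → Unique (grow α)
grow-unique (comp []      _) = [] ∷ []
grow-unique (comp (a ∷ α) _) = ((λ eq → longer (cong (length ∘ parts) eq)) ∷ []) ∷ [] ∷ []
  where
  longer : ∀ {n} → suc n ≢ n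
  longer ()

compositions-unique : ∀ n → Unique (compositions n)
compositions-unique zero    = [] ∷ []
compositions-unique (suc n) = Uniqueₚ.concat⁺
  (Allₚ.map⁺ (All.universal grow-unique (compositions n)))
  (AllPairsₚ.map⁺ (AllPairs.map
    (λ { {α} {β} α≢β (p , q) → α≢β (parts-injective (trans (sym (shrink-grow α p)) (shrink-grow β q))) })
    (compositions-unique n)))
  where
  parts-injective : ∀ {α β} → parts α ≡ parts β → α ≡ β
  parts-injective refl = refl

------------------------------------------------------------------------
-- Polycompositions

-- The list (α⁽¹⁾ , … , α⁽ˢ⁾), with α⁽ⁱ⁾ empty for i > s.
Polycomposition : Set
Polycomposition = List Composition

weight : Polycomposition → ℕ
weight = index-sum ∣_∣ᶜ

_¹ : Composition → Polycomposition
α ¹ = [ α ]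

SquareFree : Polycomposition → Set
SquareFree δ = Σ[ α ∈ Composition ] δ ≡ α ¹

PCom-sqf : ℕ → List (∃ SquareFree)
PCom-sqf d = map (λ α → α ¹ , α , refl) (compositions d)

weight-¹ : ∀ α → weight (α ¹) ≡ ∣ α ∣ᶜ
weight-¹ α = trans (+-identityʳ _) (+-identityʳ _)

PCom-sqf-complete : ∀ d (δ : ∃ SquareFree) → weight (proj₁ δ) ≡ d → δ ∈ PCom-sqf d
PCom-sqf-complete d (_ , α , refl) eq =
  ∈-map⁺ _ (compositions-complete d α (trans (sym (weight-¹ α)) eq))

PCom-sqf-sound : ∀ d {δ : ∃ SquareFree} → δ ∈ PCom-sqf d → weight (proj₁ δ) ≡ d
PCom-sqf-sound d δ∈ with ∈-map⁻ _ δ∈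
... | α , α∈ , refl = trans (weight-¹ α) (compositions-sound d α∈)

PCom-sqf-unique : ∀ d → Unique (PCom-sqf d)
PCom-sqf-unique d = Uniqueₚ.map⁺ (cong (proj₁ ∘ proj₂)) (compositions-unique d)

Z : ∃ SquareFree → ℕ
Z (_ , α , _) = Zᶜ α

Z≢0 : ∀ δ → NonZero (Z δ)
Z≢0 (_ , comp α ps , _) = partial-sum-product≢0 0 α (recover ps)

-- Product of the P_{dʳ} over the blocks dʳ, where the list holds
-- α⁽ʳ⁾ , α⁽ʳ⁺¹⁾ , …
block-product-from : (r : ℕ) → .{{NonZero r}} → Polycomposition → Series
block-product-from r []      = 𝟙
block-product-from r (α ∷ δ) = ∏ (map (λ d → P d [x^ r ]) (parts α)) ⊛ block-product-from (suc r) δ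

P⟨_⟩ : Polycomposition → Series
P⟨ δ ⟩ = block-product-from 1 δ

module Submission where

-- Write H(t) = Σ H_d t^d.  Logarithmic differentiation of Π 1/(1 − x_{ij} t^i)
-- gives d·H_d = Σ_{a=1}^d H_{d−a} P_a, which at a monomial m of degree d says
-- that the pairs (x_{ij}, e) with 1 ≤ e ≤ m_{ij}, each of weight i, have total
-- weight deg m.  On the other side Z_α = d·Z_{α′} when α is a composition of d
-- and α′ is α without its last part a, so Σ P_α/Z_α satisfies the same
-- recursion, and the two sides agree by induction on d.

-- A factorization of a monomial splits every exponent independently, so a sum over factorizations
-- of a product of per-entry factors is a product of sums over single entries. Associativity, the
-- left unit law and the count of ways to split off x_{ij}^e are therefore settled for one natural
-- number and lifted twice, to rows and then to tables. There is exactly one factorization with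
-- second factor x_{ij}^e if e ≤ m_{ij}, and none otherwise. Hence, for deg m = d, the coefficient
-- of H_{d-a} P_a at m counts the pairs (x_{ij}, e) with i·e = a and e ≤ m_{ij}, each with weight i.
-- Every pair belongs to a single a, and i·e ≤ deg m keeps that a within 1, ..., d. Products are
-- nested to the right, so the last part of a composition sits innermost. This is why the product
-- over a composition is given a variable innermost factor.

open import Defs
open import Algebra.Bundles using (CommutativeMonoid)
import Algebra.Properties.CommutativeSemigroup as CommutativeSemigroup
open import Data.Bool using (if_then_else_)
open import Data.Empty using (⊥-elim)
import Data.Integer as ℤ
import Data.Integer.Properties as ℤ
open import Data.List using (List; []; _∷_; [_]; _++_; _∷ʳ_; map; concatMap; foldr; length; replicate; upTo; filter; cartesianProductWith)
open import Data.List.Membership.Propositional.Properties using (∈-upTo⁻)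
import Data.List.Properties as List
open import Data.List.Relation.Unary.All as All using (All; []; _∷_; all?)
import Data.List.Relation.Unary.All.Properties as Allₚ
open import Data.Nat using (ℕ; zero; suc; _+_; _*_; _∸_; _⊔_; _≤_; _<_; z≤n; s≤s; _≟_; _≤?_; NonZero)
open import Data.Nat.Divisibility using (_∣_; _∣?_; 1∣_; m∣m*n; ∣⇒≤)
open import Data.Nat.DivMod using (_/_; m*[n/m]≡n; m*n/n≡m; n/1≡n)
open import Data.Nat.ListAction using (sum)
import Data.Nat.Properties as ℕ
open import Data.Product using (_×_; _,_; proj₁; proj₂)
open import Data.Rational as ℚ using (ℚ; 0ℚ; 1ℚ; fromℚᵘ)
import Data.Rational.Properties as ℚ
import Data.Rational.Unnormalised as ℚᵘ
open ℚᵘ using (mkℚᵘ; *≡*)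
import Data.Rational.Unnormalised.Properties as ℚᵘ
open import Data.Sum using (_⊎_; inj₁; inj₂; [_,_]′)
open import Function using (_∘_; id; _⇔_; mk⇔; Equivalence)
open import Relation.Binary.PropositionalEquality hiding ([_])
open import Relation.Nullary using (Dec; yes; no; does; ¬_; _×-dec_)
open import Relation.Nullary.Decidable using (does-⇔; dec-true; dec-false)

open CommutativeSemigroup ℕ.+-commutativeSemigroup using ()
  renaming (interchange to ℕ+-interchange)
open CommutativeSemigroup (CommutativeMonoid.commutativeSemigroup ℚ.+-0-commutativeMonoid) using ()
  renaming (interchange to +-interchange)
open CommutativeSemigroup (CommutativeMonoid.commutativeSemigroup ℚ.*-1-commutativeMonoid) using ()
  renaming (x∙yz≈y∙xz to *-swapˡ)

-- Rational arithmetic and finite sums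

-- Operations on `ℚ` normalise by a gcd that is stuck on variables; through this map an identity can
-- be checked on unnormalised fractions by cross-multiplication.
fromℚᵘ-homo-+ : ∀ p q → fromℚᵘ (p ℚᵘ.+ q) ≡ fromℚᵘ p ℚ.+ fromℚᵘ q
fromℚᵘ-homo-+ p q = ℚ.toℚᵘ-injective (ℚᵘ.≃-trans (ℚ.toℚᵘ-fromℚᵘ (p ℚᵘ.+ q)) (ℚᵘ.≃-sym
  (ℚᵘ.≃-trans (ℚ.toℚᵘ-homo-+ (fromℚᵘ p) (fromℚᵘ q))
              (ℚᵘ.+-cong (ℚ.toℚᵘ-fromℚᵘ p) (ℚ.toℚᵘ-fromℚᵘ q)))))

fromℚᵘ-homo-* : ∀ p q → fromℚᵘ (p ℚᵘ.* q) ≡ fromℚᵘ p ℚ.* fromℚᵘ q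
fromℚᵘ-homo-* p q = ℚ.toℚᵘ-injective (ℚᵘ.≃-trans (ℚ.toℚᵘ-fromℚᵘ (p ℚᵘ.* q)) (ℚᵘ.≃-sym
  (ℚᵘ.≃-trans (ℚ.toℚᵘ-homo-* (fromℚᵘ p) (fromℚᵘ q))
              (ℚᵘ.*-cong (ℚ.toℚᵘ-fromℚᵘ p) (ℚ.toℚᵘ-fromℚᵘ q)))))

ℕ→ℚ-+ : ∀ m n → ℕ→ℚ (m + n) ≡ ℕ→ℚ m ℚ.+ ℕ→ℚ n
ℕ→ℚ-+ m n = trans
  (ℚ.fromℚᵘ-cong {mkℚᵘ (ℤ.+ (m + n)) 0} {mkℚᵘ (ℤ.+ m) 0 ℚᵘ.+ mkℚᵘ (ℤ.+ n) 0}
    (*≡* (cong₂ (λ a b → (a ℤ.+ b) ℤ.* ℤ.+ 1)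
      (sym (ℤ.*-identityʳ (ℤ.+ m))) (sym (ℤ.*-identityʳ (ℤ.+ n))))))
  (fromℚᵘ-homo-+ (mkℚᵘ (ℤ.+ m) 0) (mkℚᵘ (ℤ.+ n) 0))

ℕ→ℚ-* : ∀ m n → ℕ→ℚ (m * n) ≡ ℕ→ℚ m ℚ.* ℕ→ℚ n
ℕ→ℚ-* m n = trans
  (ℚ.fromℚᵘ-cong {mkℚᵘ (ℤ.+ (m * n)) 0} {mkℚᵘ (ℤ.+ m) 0 ℚᵘ.* mkℚᵘ (ℤ.+ n) 0}
    (*≡* (cong (ℤ._* ℤ.+ 1) (ℤ.pos-* m n))))
  (fromℚᵘ-homo-* (mkℚᵘ (ℤ.+ m) 0) (mkℚᵘ (ℤ.+ n) 0))

-- recip 0 is a junk value; with it recip is total, so that weights 1/Z can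
-- be attached to arbitrary lists.
recip : ℕ → ℚ
recip zero    = 0ℚ
recip (suc n) = ℤ.+ 1 ℚ./ suc n

recip-NonZero : ∀ n .{{_ : NonZero n}} → ℤ.+ 1 ℚ./ n ≡ recip n
recip-NonZero (suc n) = refl

recip-* : ∀ m n → recip (m * n) ≡ recip m ℚ.* recip n
recip-* zero    n       = sym (ℚ.*-zeroˡ (recip n))
recip-* (suc m) zero    rewrite ℕ.*-zeroʳ m = sym (ℚ.*-zeroʳ (recip (suc m)))
recip-* (suc m) (suc n) = fromℚᵘ-homo-* (mkℚᵘ (ℤ.+ 1) m) (mkℚᵘ (ℤ.+ 1) n)

recip-inverse : ∀ n → recip (suc n) ℚ.* ℕ→ℚ (suc n) ≡ 1ℚ
recip-inverse n = trans (sym (fromℚᵘ-homo-* (mkℚᵘ (ℤ.+ 1) n) (mkℚᵘ (ℤ.+ suc n) 0)))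
  (ℚ.fromℚᵘ-cong {mkℚᵘ (ℤ.+ 1) n ℚᵘ.* mkℚᵘ (ℤ.+ suc n) 0} {mkℚᵘ (ℤ.+ 1) 0}
    (*≡* (trans (ℤ.*-identityʳ _) (trans (ℤ.*-identityˡ _)
      (sym (trans (ℤ.*-identityˡ _) (cong ℤ.+_ (ℕ.*-identityʳ (suc n)))))))))

-- `H d m` and `⟦ u ⟧ m` unfold to such indicators, so their coefficients are computed with the laws
-- below.
𝟏 : {A : Set} → Dec A → ℚ
𝟏 a? = if does a? then 1ℚ else 0ℚ

module _ {A : Set} where

  𝟏-yes : (a? : Dec A) → A → 𝟏 a? ≡ 1ℚ
  𝟏-yes a? a rewrite dec-true a? a = refl

  𝟏-no : (a? : Dec A) → ¬ A → 𝟏 a? ≡ 0ℚ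
  𝟏-no a? ¬a rewrite dec-false a? ¬a = refl

  𝟏-⇔ : {B : Set} → A ⇔ B → (a? : Dec A) (b? : Dec B) → 𝟏 a? ≡ 𝟏 b?
  𝟏-⇔ e a? b? rewrite does-⇔ e a? b? = refl

  𝟏-× : {B : Set} (a? : Dec A) (b? : Dec B) → 𝟏 (a? ×-dec b?) ≡ 𝟏 a? ℚ.* 𝟏 b?
  𝟏-× (yes _) b? = sym (ℚ.*-identityˡ _)
  𝟏-× (no _)  b? = sym (ℚ.*-zeroˡ (𝟏 b?))

  𝟏-⊎ : {B C : Set} (a? : Dec A) (b? : Dec B) (c? : Dec C) →
        A ⇔ (B ⊎ C) → ¬ (B × C) → 𝟏 a? ≡ 𝟏 b? ℚ.+ 𝟏 c?
  𝟏-⊎ a? (yes b) (yes c) e d = ⊥-elim (d (b , c))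
  𝟏-⊎ a? (yes b) (no _)  e d = 𝟏-yes a? (Equivalence.from e (inj₁ b))
  𝟏-⊎ a? (no _)  (yes c) e d = 𝟏-yes a? (Equivalence.from e (inj₂ c))
  𝟏-⊎ a? (no ¬b) (no ¬c) e d = 𝟏-no a? λ a → [ ¬b , ¬c ]′ (Equivalence.to e a)

  𝟏-*-cong : (a? : Dec A) {p q : ℚ} → (A → p ≡ q) → 𝟏 a? ℚ.* p ≡ 𝟏 a? ℚ.* q
  𝟏-*-cong (yes a) eq = cong (1ℚ ℚ.*_) (eq a)
  𝟏-*-cong (no _) {p} {q} eq = trans (ℚ.*-zeroˡ p) (sym (ℚ.*-zeroˡ q))

∑ℚ : {A : Set} → List A → (A → ℚ) → ℚ
∑ℚ as f = sumℚ (map f as)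

module _ {A : Set} where

  ∑ℚ-cong : ∀ as {f g : A → ℚ} → (∀ a → f a ≡ g a) → ∑ℚ as f ≡ ∑ℚ as g
  ∑ℚ-cong as f≗g = cong sumℚ (List.map-cong f≗g as)

  ∑ℚ-cong-All : ∀ {Q : A → Set} {as} {f g : A → ℚ} → All Q as →
                (∀ a → Q a → f a ≡ g a) → ∑ℚ as f ≡ ∑ℚ as g
  ∑ℚ-cong-All []       h = refl
  ∑ℚ-cong-All (q ∷ qs) h = cong₂ ℚ._+_ (h _ q) (∑ℚ-cong-All qs h)

  ∑ℚ-zero : ∀ (as : List A) → ∑ℚ as (λ _ → 0ℚ) ≡ 0ℚ
  ∑ℚ-zero []       = refl
  ∑ℚ-zero (a ∷ as) = trans (ℚ.+-identityˡ _) (∑ℚ-zero as)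

  ∑ℚ-+ : ∀ as (f g : A → ℚ) → ∑ℚ as (λ a → f a ℚ.+ g a) ≡ ∑ℚ as f ℚ.+ ∑ℚ as g
  ∑ℚ-+ []       f g = refl
  ∑ℚ-+ (a ∷ as) f g = trans (cong ((f a ℚ.+ g a) ℚ.+_) (∑ℚ-+ as f g))
                            (+-interchange (f a) (g a) (∑ℚ as f) (∑ℚ as g))

  ∑ℚ-*ˡ : ∀ as c (f : A → ℚ) → ∑ℚ as (λ a → c ℚ.* f a) ≡ c ℚ.* ∑ℚ as f
  ∑ℚ-*ˡ []       c f = sym (ℚ.*-zeroʳ c)
  ∑ℚ-*ˡ (a ∷ as) c f = trans (cong (c ℚ.* f a ℚ.+_) (∑ℚ-*ˡ as c f)) (sym (ℚ.*-distribˡ-+ c _ _))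

  ∑ℚ-*ʳ : ∀ as c (f : A → ℚ) → ∑ℚ as (λ a → f a ℚ.* c) ≡ ∑ℚ as f ℚ.* c
  ∑ℚ-*ʳ as c f = trans (∑ℚ-cong as λ a → ℚ.*-comm (f a) c) (trans (∑ℚ-*ˡ as c f) (ℚ.*-comm c _))

  ∑ℚ-++ : ∀ as bs (f : A → ℚ) → ∑ℚ (as ++ bs) f ≡ ∑ℚ as f ℚ.+ ∑ℚ bs f
  ∑ℚ-++ []       bs f = sym (ℚ.+-identityˡ _)
  ∑ℚ-++ (a ∷ as) bs f = trans (cong (f a ℚ.+_) (∑ℚ-++ as bs f)) (sym (ℚ.+-assoc (f a) _ _))

  ∑ℚ-filter : ∀ {Q : A → Set} (Q? : ∀ a → Dec (Q a)) as (f : A → ℚ) →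
              ∑ℚ (filter Q? as) f ≡ ∑ℚ as (λ a → 𝟏 (Q? a) ℚ.* f a)
  ∑ℚ-filter Q? []       f = refl
  ∑ℚ-filter Q? (a ∷ as) f with Q? a
  ... | yes _ = cong₂ ℚ._+_ (sym (ℚ.*-identityˡ (f a))) (∑ℚ-filter Q? as f)
  ... | no _  = trans (∑ℚ-filter Q? as f)
                (sym (trans (cong (ℚ._+ _) (ℚ.*-zeroˡ (f a))) (ℚ.+-identityˡ _)))

module _ {A B : Set} where

  ∑ℚ-map : ∀ as (h : A → B) f → ∑ℚ (map h as) f ≡ ∑ℚ as (f ∘ h)
  ∑ℚ-map as h f = cong sumℚ (sym (List.map-∘ as))

  ∑ℚ-concatMap : ∀ as (h : A → List B) f → ∑ℚ (concatMap h as) f ≡ ∑ℚ as (λ a → ∑ℚ (h a) f)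
  ∑ℚ-concatMap []       h f = refl
  ∑ℚ-concatMap (a ∷ as) h f = trans (∑ℚ-++ (h a) _ f) (cong (∑ℚ (h a) f ℚ.+_) (∑ℚ-concatMap as h f))

  ∑ℚ-swap : ∀ as bs (f : A → B → ℚ) →
            ∑ℚ as (λ a → ∑ℚ bs (f a)) ≡ ∑ℚ bs (λ b → ∑ℚ as (λ a → f a b))
  ∑ℚ-swap []       bs f = sym (∑ℚ-zero bs)
  ∑ℚ-swap (a ∷ as) bs f = trans (cong (∑ℚ bs (f a) ℚ.+_) (∑ℚ-swap as bs f))
                                (sym (∑ℚ-+ bs (f a) _))

  ∑ℚ-product : ∀ as bs (f : A → ℚ) (g : B → ℚ) →
               ∑ℚ as (λ a → ∑ℚ bs (λ b → f a ℚ.* g b)) ≡ ∑ℚ as f ℚ.* ∑ℚ bs g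
  ∑ℚ-product as bs f g = trans (∑ℚ-cong as λ a → ∑ℚ-*ˡ bs (f a) g) (∑ℚ-*ʳ as _ f)

∑ℚ-cartesianProductWith : ∀ {A B C : Set} (h : A → B → C) as bs f →
  ∑ℚ (cartesianProductWith h as bs) f ≡ ∑ℚ as (λ a → ∑ℚ bs (λ b → f (h a b)))
∑ℚ-cartesianProductWith h []       bs f = refl
∑ℚ-cartesianProductWith h (a ∷ as) bs f =
  trans (∑ℚ-++ (map (h a) bs) _ f)
        (cong₂ ℚ._+_ (∑ℚ-map bs (h a) f) (∑ℚ-cartesianProductWith h as bs f))

∑ℚ-upTo-suc : ∀ n f → ∑ℚ (upTo (suc n)) f ≡ f 0 ℚ.+ ∑ℚ (upTo n) (f ∘ suc)
∑ℚ-upTo-suc n f = cong (λ as → f 0 ℚ.+ sumℚ as)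
  (trans (List.map-applyUpTo suc f n) (sym (List.map-applyUpTo id (f ∘ suc) n)))

-- Brings sums whose range depends on an outer index to a common range, so that the two sums can be
-- interchanged.
∑ℚ-upTo-extend : ∀ {m n} → m ≤ n → ∀ f → (∀ i → m ≤ i → f i ≡ 0ℚ) →
                 ∑ℚ (upTo n) f ≡ ∑ℚ (upTo m) f
∑ℚ-upTo-extend {n = n} z≤n f z = trans (∑ℚ-cong (upTo n) λ i → z i z≤n) (∑ℚ-zero (upTo n))
∑ℚ-upTo-extend {suc m} {suc n} (s≤s m≤n) f z = trans (∑ℚ-upTo-suc n f)
  (trans (cong (f 0 ℚ.+_) (∑ℚ-upTo-extend m≤n (f ∘ suc) λ i m≤i → z (suc i) (s≤s m≤i)))
         (sym (∑ℚ-upTo-suc m f)))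

∑ℚ-upTo-δ : ∀ {c n} → c < n → ∑ℚ (upTo n) (λ k → 𝟏 (k ≟ c)) ≡ 1ℚ
∑ℚ-upTo-δ {zero} {suc n} _ = trans (∑ℚ-upTo-suc n λ k → 𝟏 (k ≟ 0))
  (cong (1ℚ ℚ.+_) (trans (∑ℚ-cong (upTo n) λ k → 𝟏-no (suc k ≟ 0) λ ()) (∑ℚ-zero (upTo n))))
∑ℚ-upTo-δ {suc c} {suc n} (s≤s c<n) = trans (∑ℚ-upTo-suc n λ k → 𝟏 (k ≟ suc c))
  (trans (ℚ.+-identityˡ _)
    (trans (∑ℚ-cong (upTo n) λ k → 𝟏-⇔ (mk⇔ ℕ.suc-injective (cong suc)) (suc k ≟ suc c) (k ≟ c))
           (∑ℚ-upTo-δ c<n)))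

-- Sums over factorizations

-- Treats a splitting `s` as a comultiplication; for `factorizations` and a product of coefficients
-- this is the convolution `⊛`.
∑-pairs : {A : Set} → (A → List (A × A)) → A → (A → A → ℚ) → ℚ
∑-pairs s y g = ∑ℚ (s y) (λ p → g (proj₁ p) (proj₂ p))

∑-pairs-cong : ∀ {A : Set} (s : A → List (A × A)) y {f g : A → A → ℚ} →
               (∀ a b → f a b ≡ g a b) → ∑-pairs s y f ≡ ∑-pairs s y g
∑-pairs-cong s y f≗g = ∑ℚ-cong (s y) λ _ → f≗g _ _

∑-pairs-+ : ∀ {A : Set} (s : A → List (A × A)) y (f g : A → A → ℚ) →
  ∑-pairs s y (λ a b → f a b ℚ.+ g a b) ≡ ∑-pairs s y f ℚ.+ ∑-pairs s y g
∑-pairs-+ s y f g = ∑ℚ-+ (s y) (λ p → f (proj₁ p) (proj₂ p)) (λ p → g (proj₁ p) (proj₂ p))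

∑-splits*-∷ : ∀ {A : Set} (s : A → List (A × A)) y ys g →
  ∑-pairs (splits* s) (y ∷ ys) g ≡
  ∑-pairs s y (λ a b → ∑-pairs (splits* s) ys (λ as bs → g (a ∷ as) (b ∷ bs)))
∑-splits*-∷ s y ys g = ∑ℚ-cartesianProductWith _ (s y) (splits* s ys) _

∑-splits : ∀ n g → ∑-pairs splits n g ≡ ∑ℚ (upTo (suc n)) (λ k → g k (n ∸ k))
∑-splits n g = ∑ℚ-map (upTo (suc n)) (λ k → k , n ∸ k) (λ p → g (proj₁ p) (proj₂ p))

∑-splits-suc : ∀ n g → ∑-pairs splits (suc n) g ≡ g 0 (suc n) ℚ.+ ∑-pairs splits n (λ a b → g (suc a) b)
∑-splits-suc n g = trans (∑-splits (suc n) g)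
  (trans (∑ℚ-upTo-suc (suc n) λ k → g k (suc n ∸ k))
         (cong (g 0 (suc n) ℚ.+_) (sym (∑-splits n λ a b → g (suc a) b))))

∑-splits-last : ∀ n g → ∑-pairs splits (suc n) g ≡ ∑-pairs splits n (λ a b → g a (suc b)) ℚ.+ g (suc n) 0
∑-splits-last zero    g = ℚ-rearrange (g 0 1) (g 1 0)
  where
  ℚ-rearrange : ∀ p q → p ℚ.+ (q ℚ.+ 0ℚ) ≡ (p ℚ.+ 0ℚ) ℚ.+ q
  ℚ-rearrange p q = cong₂ ℚ._+_ (sym (ℚ.+-identityʳ p)) (ℚ.+-identityʳ q)
∑-splits-last (suc n) g = trans (∑-splits-suc (suc n) g)
  (trans (cong (g 0 (suc (suc n)) ℚ.+_) (∑-splits-last n λ a b → g (suc a) b))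
  (trans (sym (ℚ.+-assoc (g 0 (suc (suc n))) _ _))
         (cong (ℚ._+ g (suc (suc n)) 0) (sym (∑-splits-suc n λ a b → g a (suc b))))))

-- Associativity of `⊛` expressed through the splitting alone, a form that passes from entries to
-- rows and from rows to tables.
Coassociative : {A : Set} → (A → List (A × A)) → Set
Coassociative {A} s = ∀ y (f : A → A → A → ℚ) →
  ∑-pairs s y (λ a b → ∑-pairs s b (f a)) ≡
  ∑-pairs s y (λ a b → ∑-pairs s a (λ c d → f c d b))

splits-coassociative : Coassociative splits
splits-coassociative zero    f = refl
splits-coassociative (suc n) f = begin
  ∑-pairs splits (suc n) (λ a b → ∑-pairs splits b (f a))
    ≡⟨ ∑-splits-suc n (λ a b → ∑-pairs splits b (f a)) ⟩
  ∑-pairs splits (suc n) (f 0) ℚ.+ ∑-pairs splits n (λ a b → ∑-pairs splits b (f (suc a)))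
    ≡⟨ cong₂ ℚ._+_ (∑-splits-suc n (f 0)) (splits-coassociative n (λ a → f (suc a))) ⟩
  (f 0 0 (suc n) ℚ.+ ∑-pairs splits n (λ a b → f 0 (suc a) b)) ℚ.+
    ∑-pairs splits n (λ a b → ∑-pairs splits a (λ c d → f (suc c) d b))
    ≡⟨ ℚ.+-assoc (f 0 0 (suc n)) _ _ ⟩
  f 0 0 (suc n) ℚ.+ (∑-pairs splits n (λ a b → f 0 (suc a) b) ℚ.+
    ∑-pairs splits n (λ a b → ∑-pairs splits a (λ c d → f (suc c) d b)))
    -- 0 splits only as (0 , 0), so the lone term becomes the summand of the outer sum at `a = 0`.
    ≡⟨ cong₂ ℚ._+_ (sym (ℚ.+-identityʳ (f 0 0 (suc n)))) (sym (∑-pairs-+ splits n (λ a b → f 0 (suc a) b) (λ a b → ∑-pairs splits a (λ c d → f (suc c) d b)))) ⟩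
  ∑-pairs splits 0 (λ c d → f c d (suc n)) ℚ.+
    ∑-pairs splits n (λ a b → f 0 (suc a) b ℚ.+ ∑-pairs splits a (λ c d → f (suc c) d b))
    ≡⟨ cong (∑-pairs splits 0 (λ c d → f c d (suc n)) ℚ.+_) (∑-pairs-cong splits n λ a b → sym (∑-splits-suc a λ c d → f c d b)) ⟩
  ∑-pairs splits 0 (λ c d → f c d (suc n)) ℚ.+
    ∑-pairs splits n (λ a b → ∑-pairs splits (suc a) (λ c d → f c d b))
    ≡⟨ ∑-splits-suc n (λ a b → ∑-pairs splits a (λ c d → f c d b)) ⟨
  ∑-pairs splits (suc n) (λ a b → ∑-pairs splits a (λ c d → f c d b)) ∎
  where open ≡-Reasoning

-- Head and tail are split independently: interchanging their sums puts the two head sums side by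
-- side for `co` and the two tail sums side by side for the induction hypothesis.
splits*-coassociative : ∀ {A : Set} (s : A → List (A × A)) → Coassociative s → Coassociative (splits* s)
splits*-coassociative     s co []       f = refl
splits*-coassociative {A} s co (y ∷ ys) f = begin
  ∑-pairs S (y ∷ ys) (λ a b → ∑-pairs S b (f a))
    ≡⟨ ∑-splits*-∷ s y ys (λ a b → ∑-pairs S b (f a)) ⟩
  ∑-pairs s y (λ a b → ∑-pairs S ys λ as bs → ∑-pairs S (b ∷ bs) (f (a ∷ as)))
    ≡⟨ ∑-pairs-cong s y (λ a b → ∑-pairs-cong S ys λ as bs → ∑-splits*-∷ s b bs (f (a ∷ as))) ⟩
  ∑-pairs s y (λ a b → ∑-pairs S ys λ as bs → ∑-pairs s b λ c d → ∑-pairs S bs (g a c d as))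
    ≡⟨ ∑-pairs-cong s y (λ a b → ∑ℚ-swap (S ys) (s b) _) ⟩
  ∑-pairs s y (λ a b → ∑-pairs s b λ c d → ∑-pairs S ys λ as bs → ∑-pairs S bs (g a c d as))
    ≡⟨ ∑-pairs-cong s y (λ a b → ∑-pairs-cong s b λ c d → splits*-coassociative s co ys (g a c d)) ⟩
  ∑-pairs s y (λ a b → ∑-pairs s b λ c d → ∑-pairs S ys λ as bs → ∑-pairs S as λ cs ds → g a c d cs ds bs)
    ≡⟨ co y (λ a c d → ∑-pairs S ys λ as bs → ∑-pairs S as λ cs ds → g a c d cs ds bs) ⟩
  ∑-pairs s y (λ a b → ∑-pairs s a λ c d → ∑-pairs S ys λ as bs → ∑-pairs S as λ cs ds → g c d b cs ds bs)
    ≡⟨ ∑-pairs-cong s y (λ a b → ∑ℚ-swap (s a) (S ys) _) ⟩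
  ∑-pairs s y (λ a b → ∑-pairs S ys λ as bs → ∑-pairs s a λ c d → ∑-pairs S as λ cs ds → g c d b cs ds bs)
    ≡⟨ ∑-pairs-cong s y (λ a b → ∑-pairs-cong S ys λ as bs → ∑-splits*-∷ s a as (λ c d → f c d (b ∷ bs))) ⟨
  ∑-pairs s y (λ a b → ∑-pairs S ys λ as bs → ∑-pairs S (a ∷ as) (λ c d → f c d (b ∷ bs)))
    ≡⟨ ∑-splits*-∷ s y ys (λ a b → ∑-pairs S a (λ c d → f c d b)) ⟨
  ∑-pairs S (y ∷ ys) (λ a b → ∑-pairs S a (λ c d → f c d b)) ∎
  where
  open ≡-Reasoning
  S = splits* s
  g : A → A → A → List A → List A → List A → ℚ
  g a c d as cs ds = f (a ∷ as) (c ∷ cs) (d ∷ ds)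

-- Factorizations with one factor prescribed

module _ {A : Set} {R : A → A → Set} (R? : ∀ a b → Dec (R a b)) (d : A) (r : R d d)
         (s : A → List (A × A)) where

  -- When the first factor is all padding, the second is the original list with its shape intact, so
  -- `g` may be any function, even one that distinguishes padded copies.
  splits*-identityˡ : (∀ y g → ∑-pairs s y (λ a b → 𝟏 (R? a d) ℚ.* g b) ≡ g y) →
    ∀ ys g → ∑-pairs (splits* s) ys (λ as bs → 𝟏 (nth-pointwise? R? d as [] r) ℚ.* g bs) ≡ g ys
  splits*-identityˡ idˡ []       g = trans (ℚ.+-identityʳ _) (ℚ.*-identityˡ _)
  splits*-identityˡ idˡ (y ∷ ys) g = begin
    ∑-pairs S (y ∷ ys) (λ as bs → 𝟏 (as ≟[]) ℚ.* g bs)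
      ≡⟨ ∑-splits*-∷ s y ys (λ as bs → 𝟏 (as ≟[]) ℚ.* g bs) ⟩
    ∑-pairs s y (λ a b → ∑-pairs S ys λ as bs → 𝟏 (R? a d ×-dec as ≟[]) ℚ.* g (b ∷ bs))
      ≡⟨ ∑-pairs-cong s y (λ a b → trans
           (∑-pairs-cong S ys λ as bs → trans (cong (ℚ._* _) (𝟏-× (R? a d) (as ≟[]))) (ℚ.*-assoc (𝟏 (R? a d)) _ _))
           (trans (∑ℚ-*ˡ (S ys) (𝟏 (R? a d)) _) (cong (𝟏 (R? a d) ℚ.*_) (splits*-identityˡ idˡ ys (λ bs → g (b ∷ bs)))))) ⟩
    ∑-pairs s y (λ a b → 𝟏 (R? a d) ℚ.* g (b ∷ ys))
      ≡⟨ idˡ y (λ b → g (b ∷ ys)) ⟩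
    g (y ∷ ys) ∎
    where
    open ≡-Reasoning
    S = splits* s
    _≟[] = λ as → nth-pointwise? R? d as [] r

  module _ (count : ∀ y → ∑-pairs s y (λ _ b → 𝟏 (R? b d)) ≡ 1ℚ) where

    product : ∀ y ys (f : A → ℚ) (g : List A → ℚ) →
      ∑-pairs s y (λ _ b → ∑-pairs (splits* s) ys (λ _ bs → f b ℚ.* g bs)) ≡
      ∑-pairs s y (λ _ b → f b) ℚ.* ∑-pairs (splits* s) ys (λ _ bs → g bs)
    product y ys f g = ∑ℚ-product (s y) (splits* s ys) (f ∘ proj₂) (g ∘ proj₂)

    count-splits* : ∀ ys → ∑-pairs (splits* s) ys (λ _ bs → 𝟏 (nth-pointwise? R? d bs [] r)) ≡ 1ℚ
    count-splits* []       = refl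
    count-splits* (y ∷ ys) = trans (∑-splits*-∷ s y ys λ _ bs → 𝟏 (nth-pointwise? R? d bs [] r))
      (trans (∑-pairs-cong s y λ a b → ∑-pairs-cong (splits* s) ys λ as bs →
                𝟏-× (R? b d) (nth-pointwise? R? d bs [] r))
      (trans (product y ys (λ b → 𝟏 (R? b d)) (λ bs → 𝟏 (nth-pointwise? R? d bs [] r)))
             (cong₂ ℚ._*_ (count y) (count-splits* ys))))

    -- Every position other than `j` must split off `d`, which by `count` happens in one way and
    -- contributes a factor 1. The condition on `s d` covers a position `j` past the end of `ys`,
    -- where the entry is the default `d`.
    count-splits*-single : s d ≡ [ (d , d) ] → ∀ j w ys →
      ∑-pairs (splits* s) ys (λ _ bs → 𝟏 (nth-pointwise? R? d bs (replicate j d ++ [ w ]) r)) ≡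
      ∑-pairs s (nth d ys j) (λ _ b → 𝟏 (R? b w))
    count-splits*-single sd zero    w [] rewrite sd =
      cong (ℚ._+ 0ℚ) (trans (𝟏-× (R? d w) (yes r)) (ℚ.*-identityʳ (𝟏 (R? d w))))
    count-splits*-single sd (suc j) w [] = trans
      (cong (ℚ._+ 0ℚ) (trans (𝟏-× (R? d d) rest?)
        (trans (cong (ℚ._* 𝟏 rest?) (𝟏-yes (R? d d) r)) (ℚ.*-identityˡ (𝟏 rest?)))))
      (count-splits*-single sd j w [])
      where rest? = nth-pointwise? R? d [] (replicate j d ++ [ w ]) r
    count-splits*-single sd zero    w (y ∷ ys) =
      trans (∑-splits*-∷ s y ys λ _ bs → 𝟏 (nth-pointwise? R? d bs [ w ] r))
      (trans (∑-pairs-cong s y λ a b → ∑-pairs-cong (splits* s) ys λ as bs →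
                𝟏-× (R? b w) (nth-pointwise? R? d bs [] r))
      (trans (product y ys (λ b → 𝟏 (R? b w)) (λ bs → 𝟏 (nth-pointwise? R? d bs [] r)))
      (trans (cong (∑-pairs s y (λ _ b → 𝟏 (R? b w)) ℚ.*_) (count-splits* ys)) (ℚ.*-identityʳ _))))
    count-splits*-single sd (suc j) w (y ∷ ys) =
      trans (∑-splits*-∷ s y ys λ _ bs → 𝟏 (nth-pointwise? R? d bs (d ∷ replicate j d ++ [ w ]) r))
      (trans (∑-pairs-cong s y λ a b → ∑-pairs-cong (splits* s) ys λ as bs →
                𝟏-× (R? b d) (nth-pointwise? R? d bs (replicate j d ++ [ w ]) r))
      (trans (product y ys (λ b → 𝟏 (R? b d)) (λ bs → 𝟏 (nth-pointwise? R? d bs (replicate j d ++ [ w ]) r)))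
      (trans (cong₂ ℚ._*_ (count y) (count-splits*-single sd j w ys)) (ℚ.*-identityˡ _))))

splits-identityˡ : ∀ n (g : ℕ → ℚ) → ∑-pairs splits n (λ a b → 𝟏 (a ≟ 0) ℚ.* g b) ≡ g n
splits-identityˡ zero    g = trans (ℚ.+-identityʳ (1ℚ ℚ.* g 0)) (ℚ.*-identityˡ (g 0))
splits-identityˡ (suc n) g = trans (∑-splits-suc n λ a b → 𝟏 (a ≟ 0) ℚ.* g b)
  (trans (cong₂ ℚ._+_ (ℚ.*-identityˡ (g (suc n)))
            (trans (∑-pairs-cong splits n λ a b → ℚ.*-zeroˡ (g b)) (∑ℚ-zero (splits n))))
         (ℚ.+-identityʳ (g (suc n))))

count-splits : ∀ n e → ∑-pairs splits n (λ _ b → 𝟏 (b ≟ e)) ≡ 𝟏 (e ≤? n)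
count-splits zero    e = trans (ℚ.+-identityʳ _) (𝟏-⇔ (mk⇔ (λ { refl → z≤n }) λ { z≤n → refl }) (0 ≟ e) (e ≤? 0))
count-splits (suc n) e = trans (∑-splits-suc n λ _ b → 𝟏 (b ≟ e))
  (trans (cong (𝟏 (suc n ≟ e) ℚ.+_) (count-splits n e))
         (sym (𝟏-⊎ (e ≤? suc n) (suc n ≟ e) (e ≤? n)
           (mk⇔ (λ e≤ → [ (λ e<sn → inj₂ (ℕ.≤-pred e<sn)) , (λ eq → inj₁ (sym eq)) ]′ (ℕ.m≤n⇒m<n∨m≡n e≤))
                (λ { (inj₁ refl) → ℕ.≤-refl ; (inj₂ e≤n) → ℕ.m≤n⇒m≤1+n e≤n }))
           λ { (refl , e≤n) → ℕ.1+n≰n e≤n })))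

row-≟? : ∀ b b′ → Dec (∀ i → nth 0 b i ≡ nth 0 b′ i)
row-≟? b b′ = nth-pointwise? _≟_ 0 b b′ refl

count-rows : ∀ b → ∑-pairs (splits* splits) b (λ _ c → 𝟏 (row-≟? c [])) ≡ 1ℚ
count-rows = count-splits* _≟_ 0 refl splits λ n → count-splits n 0

count-factorizations-𝟙 : ∀ m → ∑-pairs factorizations m (λ _ → 𝟙) ≡ 1ℚ
count-factorizations-𝟙 = count-splits* row-≟? [] (λ _ → refl) (splits* splits) count-rows

-- The single-position count is applied twice, isolating row `i` of the table and then entry `j` of
-- that row.
count-factorizations-power : ∀ m i j e → ∑-pairs factorizations m (λ _ → ⟦ x (i , j) ^ₘ e ⟧) ≡ 𝟏 (e ≤? exponent m i j)
count-factorizations-power m i j e =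
  trans (count-splits*-single row-≟? [] (λ _ → refl) (splits* splits) count-rows refl i (replicate j 0 ++ [ e ]) m)
  (trans (count-splits*-single _≟_ 0 refl splits (λ n → count-splits n 0) refl j e (nth [] m i))
         (count-splits (exponent m i j) e))

-- Algebra of the product of series

⊛-assoc : ∀ F G K → F ⊛ (G ⊛ K) ≈ (F ⊛ G) ⊛ K
⊛-assoc F G K m = begin
  (F ⊛ (G ⊛ K)) m
    ≡⟨ ∑-pairs-cong factorizations m (λ u v → sym (∑ℚ-*ˡ (factorizations v) (F u) _)) ⟩
  ∑-pairs factorizations m (λ u v → ∑-pairs factorizations v (λ c d → F u ℚ.* (G c ℚ.* K d)))
    ≡⟨ splits*-coassociative _ (splits*-coassociative _ splits-coassociative) m (λ a c d → F a ℚ.* (G c ℚ.* K d)) ⟩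
  ∑-pairs factorizations m (λ u v → ∑-pairs factorizations u (λ c d → F c ℚ.* (G d ℚ.* K v)))
    ≡⟨ ∑-pairs-cong factorizations m (λ u v → trans
         (∑-pairs-cong factorizations u λ c d → sym (ℚ.*-assoc (F c) (G d) (K v)))
         (∑ℚ-*ʳ (factorizations u) (K v) _)) ⟩
  ((F ⊛ G) ⊛ K) m ∎
  where open ≡-Reasoning

⊛-identityˡ : ∀ F → 𝟙 ⊛ F ≈ F
⊛-identityˡ F m = splits*-identityˡ row-≟? [] (λ _ → refl) (splits* splits)
  (splits*-identityˡ _≟_ 0 refl splits splits-identityˡ) m F

⊛-congˡ : ∀ F {G K} → G ≈ K → F ⊛ G ≈ F ⊛ K
⊛-congˡ F G≈K m = ∑-pairs-cong factorizations m λ u v → cong (F u ℚ.*_) (G≈K v)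

⊛-congʳ : ∀ F {G K} → G ≈ K → G ⊛ F ≈ K ⊛ F
⊛-congʳ F G≈K m = ∑-pairs-cong factorizations m λ u v → cong (ℚ._* F v) (G≈K u)

-- Degrees, and the recursion for H

-- Relational form of membership in `splits*`: it retains the common shape, which controls widths,
-- and the entrywise relation, which controls degrees.
data Split* {A : Set} (R : A → A → A → Set) : List A → List A → List A → Set where
  []  : Split* R [] [] []
  _∷_ : ∀ {y a b ys as bs} → R y a b → Split* R ys as bs → Split* R (y ∷ ys) (a ∷ as) (b ∷ bs)

Splits : {A : Set} → (A → A → A → Set) → (A → List (A × A)) → Set
Splits R s = ∀ y → All (λ p → R y (proj₁ p) (proj₂ p)) (s y)

splits*-Splits : ∀ {A : Set} {R : A → A → A → Set} {s} → Splits R s → Splits (Split* R) (splits* s)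
splits*-Splits {s = s} h []       = [] ∷ []
splits*-Splits {s = s} h (y ∷ ys) = Allₚ.cartesianProductWith⁺ (setoid _) (setoid _) _ (s y) (splits* s ys)
  λ p∈ q∈ → All.lookup (h y) p∈ ∷ All.lookup (splits*-Splits h ys) q∈

_Sums-to_ : ∀ {A : Set} → (A → ℕ) → A → A → A → Set
(f Sums-to y) a b = f a + f b ≡ f y

splits-Sums-to : Splits (id Sums-to_) splits
splits-Sums-to n = Allₚ.map⁺ (All.tabulate {xs = upTo (suc n)} λ k∈ → ℕ.m+[n∸m]≡n (ℕ.≤-pred (∈-upTo⁻ k∈)))

Split*-sum : ∀ {r as bs} → Split* (id Sums-to_) r as bs → (sum Sums-to r) as bs
Split*-sum []                          = refl
Split*-sum {y ∷ r} {a ∷ as} {b ∷ bs} (eq ∷ eqs) = trans (ℕ+-interchange a (sum as) b (sum bs)) (cong₂ _+_ eq (Split*-sum eqs))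

Split*-length : ∀ {A : Set} {R : A → A → A → Set} {ys as bs} → Split* R ys as bs → length bs ≡ length ys
Split*-length []       = refl
Split*-length (_ ∷ rs) = cong suc (Split*-length rs)

RowSplit : List ℕ → List ℕ → List ℕ → Set
RowSplit = Split* (id Sums-to_)

Factorization : Monomial → Monomial → Monomial → Set
Factorization = Split* RowSplit

factorizations-sound : Splits Factorization factorizations
factorizations-sound = splits*-Splits (splits*-Splits splits-Sums-to)

index-sum-from-factorization : ∀ i {m u v} → Factorization m u v →
  index-sum-from i sum u + index-sum-from i sum v ≡ index-sum-from i sum m
index-sum-from-factorization i []                               = refl
index-sum-from-factorization i {r ∷ m} {a ∷ u} {b ∷ v} (rs ∷ rss) = trans
  (ℕ+-interchange (i * sum a) _ (i * sum b) _)
  (cong₂ _+_ (trans (sym (ℕ.*-distribˡ-+ i (sum a) (sum b))) (cong (i *_) (Split*-sum rs)))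
             (index-sum-from-factorization (suc i) rss))

degree-factorization : ∀ {m u v} → Factorization m u v → degree u + degree v ≡ degree m
degree-factorization = index-sum-from-factorization 1

-- `∑ⱼx_^_` cuts its sum at the width of its argument; this makes the cut the same for all second
-- factors, so the sum over j can be moved out of the sum over factorizations.
width-factorization : ∀ {m u v} → Factorization m u v → width v ≡ width m
width-factorization []         = refl
width-factorization (rs ∷ rss) = cong₂ _⊔_ (Split*-length rs) (width-factorization rss)

∑-factorizations-cong : ∀ m {f g : Monomial → Monomial → ℚ} →
  (∀ u v → Factorization m u v → f u v ≡ g u v) → ∑-pairs factorizations m f ≡ ∑-pairs factorizations m g
∑-factorizations-cong m h = ∑ℚ-cong-All (factorizations-sound m) λ _ → h _ _

sum-cong : ∀ r r′ → (∀ j → nth 0 r j ≡ nth 0 r′ j) → sum r ≡ sum r′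
sum-cong []      []        eq = refl
sum-cong []      (b ∷ r′)  eq = cong₂ _+_ (eq 0) (sum-cong [] r′ (eq ∘ suc))
sum-cong (a ∷ r) []        eq = cong₂ _+_ (eq 0) (sum-cong r [] (eq ∘ suc))
sum-cong (a ∷ r) (b ∷ r′)  eq = cong₂ _+_ (eq 0) (sum-cong r r′ (eq ∘ suc))

index-sum-from-cong : ∀ i m m′ → m ≈ₘ m′ → index-sum-from i sum m ≡ index-sum-from i sum m′
index-sum-from-cong i []      []       eq = refl
index-sum-from-cong i []      (r ∷ m′) eq = trans (sym (cong (_+ 0) (ℕ.*-zeroʳ i)))
  (cong₂ _+_ (cong (i *_) (sum-cong [] r (eq 0))) (index-sum-from-cong (suc i) [] m′ (eq ∘ suc)))
index-sum-from-cong i (r ∷ m) []       eq = trans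
  (cong₂ _+_ (cong (i *_) (sum-cong r [] (eq 0))) (index-sum-from-cong (suc i) m [] (eq ∘ suc)))
  (cong (_+ 0) (ℕ.*-zeroʳ i))
index-sum-from-cong i (r ∷ m) (r′ ∷ m′) eq =
  cong₂ _+_ (cong (i *_) (sum-cong r r′ (eq 0))) (index-sum-from-cong (suc i) m m′ (eq ∘ suc))

degree-cong : ∀ m m′ → m ≈ₘ m′ → degree m ≡ degree m′
degree-cong = index-sum-from-cong 1

degree-power : ∀ i j e → degree (x (i , j) ^ₘ e) ≡ suc i * e
degree-power i j e = trans (table 1 i) (cong (suc i *_) (row j))
  where
  row : ∀ j → sum (replicate j 0 ++ [ e ]) ≡ e
  row zero    = ℕ.+-identityʳ e
  row (suc j) = row j
  table : ∀ s i {r} → index-sum-from s sum (replicate i [] ++ [ r ]) ≡ (s + i) * sum r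
  table s zero    rewrite ℕ.+-identityʳ s = ℕ.+-identityʳ _
  table s (suc i) {r} rewrite ℕ.*-zeroʳ s = trans (table (suc s) i) (cong (_* sum r) (sym (ℕ.+-suc s i)))

ℕ→ℚ-sum : ∀ r {W} → length r ≤ W → ℕ→ℚ (sum r) ≡ ∑ℚ (upTo W) (λ j → ℕ→ℚ (nth 0 r j))
ℕ→ℚ-sum []      {W}     _         = sym (∑ℚ-zero (upTo W))
ℕ→ℚ-sum (a ∷ r) {suc W} (s≤s l≤W) = trans (ℕ→ℚ-+ a (sum r))
  (trans (cong (ℕ→ℚ a ℚ.+_) (ℕ→ℚ-sum r l≤W)) (sym (∑ℚ-upTo-suc W λ j → ℕ→ℚ (nth 0 (a ∷ r) j))))

-- The rectangle `I` by `W` may exceed the table, since exponents outside it are 0; this leaves room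
-- for a row range that also covers all divisors.
ℕ→ℚ-index-sum-from : ∀ s m {I W} → length m ≤ I → width m ≤ W →
  ℕ→ℚ (index-sum-from s sum m) ≡
  ∑ℚ (upTo I) (λ i → ℕ→ℚ (s + i) ℚ.* ∑ℚ (upTo W) (λ j → ℕ→ℚ (exponent m i j)))
ℕ→ℚ-index-sum-from s [] {I} {W} _ _ = sym (trans
  (∑ℚ-cong (upTo I) λ i → trans (cong (ℕ→ℚ (s + i) ℚ.*_) (∑ℚ-zero (upTo W))) (ℚ.*-zeroʳ (ℕ→ℚ (s + i))))
  (∑ℚ-zero (upTo I)))
ℕ→ℚ-index-sum-from s (r ∷ m) {suc I} {W} (s≤s l≤I) w≤W = begin
  ℕ→ℚ (s * sum r + index-sum-from (suc s) sum m)
    ≡⟨ ℕ→ℚ-+ (s * sum r) (index-sum-from (suc s) sum m) ⟩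
  ℕ→ℚ (s * sum r) ℚ.+ ℕ→ℚ (index-sum-from (suc s) sum m)
    ≡⟨ cong₂ ℚ._+_
         (trans (ℕ→ℚ-* s (sum r)) (cong₂ (λ k → ℕ→ℚ k ℚ.*_) (sym (ℕ.+-identityʳ s)) (ℕ→ℚ-sum r (ℕ.m⊔n≤o⇒m≤o (length r) _ w≤W))))
         (trans (ℕ→ℚ-index-sum-from (suc s) m l≤I (ℕ.m⊔n≤o⇒n≤o (length r) _ w≤W))
                (∑ℚ-cong (upTo I) λ i → cong (λ k → ℕ→ℚ k ℚ.* row m i) (sym (ℕ.+-suc s i)))) ⟩
  ℕ→ℚ (s + 0) ℚ.* row (r ∷ m) 0 ℚ.+ ∑ℚ (upTo I) (λ i → ℕ→ℚ (s + suc i) ℚ.* row (r ∷ m) (suc i))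
    ≡⟨ ∑ℚ-upTo-suc I (λ i → ℕ→ℚ (s + i) ℚ.* row (r ∷ m) i) ⟨
  ∑ℚ (upTo (suc I)) (λ i → ℕ→ℚ (s + i) ℚ.* row (r ∷ m) i) ∎
  where
  open ≡-Reasoning
  row : Monomial → ℕ → ℚ
  row m i = ∑ℚ (upTo W) (λ j → ℕ→ℚ (exponent m i j))

ℕ→ℚ-degree : ∀ m {I} → length m ≤ I →
  ℕ→ℚ (degree m) ≡ ∑ℚ (upTo I) (λ i → ℕ→ℚ (suc i) ℚ.* ∑ℚ (upTo (width m)) (λ j → ℕ→ℚ (exponent m i j)))
ℕ→ℚ-degree m {I} l≤I = ℕ→ℚ-index-sum-from 1 m l≤I ℕ.≤-refl

nth≤sum : ∀ r j → nth 0 r j ≤ sum r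
nth≤sum []      j       = z≤n
nth≤sum (a ∷ r) zero    = ℕ.m≤m+n a (sum r)
nth≤sum (a ∷ r) (suc j) = ℕ.≤-trans (nth≤sum r j) (ℕ.m≤n+m (sum r) a)

exponent≤index-sum-from : ∀ s m i j → (s + i) * exponent m i j ≤ index-sum-from s sum m
exponent≤index-sum-from s []      i       j rewrite ℕ.*-zeroʳ (s + i) = z≤n
exponent≤index-sum-from s (r ∷ m) zero    j rewrite ℕ.+-identityʳ s = ℕ.≤-trans (ℕ.*-monoʳ-≤ s (nth≤sum r j)) (ℕ.m≤m+n (s * sum r) _)
exponent≤index-sum-from s (r ∷ m) (suc i) j = ℕ.≤-trans
  (subst (λ k → k * exponent m i j ≤ index-sum-from (suc s) sum m) (sym (ℕ.+-suc s i)) (exponent≤index-sum-from (suc s) m i j))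
  (ℕ.m≤n+m _ (s * sum r))

exponent≤degree : ∀ m i j → suc i * exponent m i j ≤ degree m
exponent≤degree m i j = exponent≤index-sum-from 1 m i j

-- A factor v ≈ x_{ij}^e forces deg u = deg m − deg v, so the weight [deg u = l]
-- can be taken out of the sum over factorizations.
H-⊛-⟦⟧ : ∀ l w m → (H l ⊛ ⟦ w ⟧) m ≡
         𝟏 (degree m ≟ l + degree w) ℚ.* ∑-pairs factorizations m (λ _ → ⟦ w ⟧)
H-⊛-⟦⟧ l w m = trans
  (∑-factorizations-cong m λ u v φ → trans (ℚ.*-comm (H l u) (⟦ w ⟧ v)) (trans
    (𝟏-*-cong (v ≈ₘ? w) λ v≈w → 𝟏-⇔ (mk⇔ (to φ v≈w) (from φ v≈w)) (degree u ≟ l) (degree m ≟ l + degree w))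
    (ℚ.*-comm (⟦ w ⟧ v) _)))
  (∑ℚ-*ˡ (factorizations m) (𝟏 (degree m ≟ l + degree w)) (⟦ w ⟧ ∘ proj₂))
  where
  eq : ∀ {u v} → Factorization m u v → v ≈ₘ w → degree u + degree w ≡ degree m
  eq {u} {v} φ v≈w = trans (cong (degree u +_) (sym (degree-cong v w v≈w))) (degree-factorization φ)
  to : ∀ {u v} → Factorization m u v → v ≈ₘ w → degree u ≡ l → degree m ≡ l + degree w
  to φ v≈w refl = sym (eq φ v≈w)
  from : ∀ {u v} → Factorization m u v → v ≈ₘ w → degree m ≡ l + degree w → degree u ≡ l
  from φ v≈w deg = ℕ.+-cancelʳ-≡ (degree w) _ _ (trans (eq φ v≈w) deg)

H-⊛-𝟙 : ∀ l → H l ⊛ 𝟙 ≈ H l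
H-⊛-𝟙 l m = trans (H-⊛-⟦⟧ l [] m) (trans (cong (𝟏 (degree m ≟ l + 0) ℚ.*_) (count-factorizations-𝟙 m))
  (trans (ℚ.*-identityʳ _) (cong (λ k → 𝟏 (degree m ≟ k)) (ℕ.+-identityʳ l))))

H-⊛-power : ∀ l i j e m → (H l ⊛ ⟦ x (i , j) ^ₘ e ⟧) m ≡
            𝟏 (degree m ≟ l + suc i * e) ℚ.* 𝟏 (e ≤? exponent m i j)
H-⊛-power l i j e m = trans (H-⊛-⟦⟧ l (x (i , j) ^ₘ e) m)
  (cong₂ (λ k → 𝟏 (degree m ≟ l + k) ℚ.*_) (degree-power i j e) (count-factorizations-power m i j e))

H₀≈𝟙 : H 0 ≈ 𝟙
H₀≈𝟙 m = 𝟏-⇔ (mk⇔ (λ deg i j → exponent≡0 i j (ℕ.n≤0⇒n≡0 (subst (suc i * exponent m i j ≤_) deg (exponent≤degree m i j)))) (degree-cong m [])) (degree m ≟ 0) (m ≈ₘ? [])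
  where
  exponent≡0 : ∀ i j → suc i * exponent m i j ≡ 0 → exponent m i j ≡ exponent [] i j
  exponent≡0 i j eq = ℕ.m+n≡0⇒m≡0 (exponent m i j) eq

-- The numbers counted are the first `t` positive multiples of `suc i`; raising the bound by one
-- admits exactly one more.
count-multiples : ∀ i t {n} → suc i * t ≤ n →
  ∑ℚ (upTo n) (λ k → 𝟏 (suc i ∣? suc k ×-dec suc k / suc i ≤? t)) ≡ ℕ→ℚ t
count-multiples i zero    {n} _ = trans
  (∑ℚ-cong (upTo n) λ k → 𝟏-no (suc i ∣? suc k ×-dec suc k / suc i ≤? 0)
    λ (i∣k , q≤0) → impossible (trans (sym (m*[n/m]≡n i∣k)) (trans (cong (suc i *_) (ℕ.n≤0⇒n≡0 q≤0)) (ℕ.*-zeroʳ (suc i)))))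
  (∑ℚ-zero (upTo n))
  where
  impossible : ∀ {k} → ¬ (suc k ≡ 0)
  impossible ()
count-multiples i (suc t) {n} c<n = begin
  ∑ℚ (upTo n) (λ k → 𝟏 (suc i ∣? suc k ×-dec suc k / suc i ≤? suc t))
    ≡⟨ ∑ℚ-cong (upTo n) (λ k → 𝟏-⊎ (suc i ∣? suc k ×-dec suc k / suc i ≤? suc t) (k ≟ c)
         (suc i ∣? suc k ×-dec suc k / suc i ≤? t) (mk⇔ (to k) (from k)) (disjoint k)) ⟩
  ∑ℚ (upTo n) (λ k → 𝟏 (k ≟ c) ℚ.+ 𝟏 (suc i ∣? suc k ×-dec suc k / suc i ≤? t))
    ≡⟨ ∑ℚ-+ (upTo n) (λ k → 𝟏 (k ≟ c)) (λ k → 𝟏 (suc i ∣? suc k ×-dec suc k / suc i ≤? t)) ⟩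
  ∑ℚ (upTo n) (λ k → 𝟏 (k ≟ c)) ℚ.+ ∑ℚ (upTo n) (λ k → 𝟏 (suc i ∣? suc k ×-dec suc k / suc i ≤? t))
    ≡⟨ cong₂ ℚ._+_ (∑ℚ-upTo-δ c<n) (count-multiples i t (ℕ.≤-trans (ℕ.*-monoʳ-≤ (suc i) (ℕ.n≤1+n t)) c<n)) ⟩
  1ℚ ℚ.+ ℕ→ℚ t
    ≡⟨ ℕ→ℚ-+ 1 t ⟨
  ℕ→ℚ (suc t) ∎
  where
  open ≡-Reasoning
  -- The new multiple `suc i * suc t` is definitionally `suc c`, as `k` stands for the number
  -- `suc k`; for the same reason the hypothesis reads `c < n`.
  c = t + i * suc t
  quotient : suc (c) / suc i ≡ suc t
  quotient = trans (cong (_/ suc i) (ℕ.*-comm (suc i) (suc t))) (m*n/n≡m (suc t) (suc i))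
  Multiple : ℕ → ℕ → Set
  Multiple t k = suc i ∣ suc k × suc k / suc i ≤ t
  to : ∀ k → Multiple (suc t) k → k ≡ c ⊎ Multiple t k
  to k (i∣k , q≤) with ℕ.m≤n⇒m<n∨m≡n q≤
  ... | inj₁ q<  = inj₂ (i∣k , ℕ.≤-pred q<)
  ... | inj₂ q≡t = inj₁ (ℕ.suc-injective (trans (sym (m*[n/m]≡n i∣k)) (cong (suc i *_) q≡t)))
  from : ∀ k → k ≡ c ⊎ Multiple t k → Multiple (suc t) k
  from k (inj₁ refl)       = m∣m*n (suc t) , ℕ.≤-reflexive quotient
  from k (inj₂ (i∣k , q≤)) = i∣k , ℕ.m≤n⇒m≤1+n q≤
  disjoint : ∀ k → ¬ (k ≡ c × Multiple t k)
  disjoint k (refl , _ , q≤) = ℕ.1+n≰n (subst (_≤ t) quotient q≤)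

-- All monomials of `P (suc k)` have degree `suc k`, so a single degree condition comes out of the
-- whole sum.
H-⊛-P : ∀ l k m → (H l ⊛ P (suc k)) m ≡ 𝟏 (degree m ≟ l + suc k) ℚ.*
  ∑ℚ (filter (λ i → suc i ∣? suc k) (upTo (suc k)))
    (λ i → ℕ→ℚ (suc i) ℚ.* ∑ℚ (upTo (width m)) (λ j → 𝟏 (suc k / suc i ≤? exponent m i j)))
H-⊛-P l k m = begin
  (H l ⊛ P (suc k)) m
    ≡⟨ ∑-factorizations-cong m (λ u v φ → trans
         (sym (∑ℚ-*ˡ divisors (H l u) (λ i → ℕ→ℚ (suc i) ℚ.* (∑ⱼx i ^ e i) v)))
         (∑ℚ-cong divisors λ i → trans (*-swapˡ (H l u) (ℕ→ℚ (suc i)) _) (cong (ℕ→ℚ (suc i) ℚ.*_) (trans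
           (cong (λ w → H l u ℚ.* ∑ (upTo w) (λ j → ⟦ x (i , j) ^ₘ e i ⟧) v) (width-factorization φ))
           (sym (∑ℚ-*ˡ (upTo (width m)) (H l u) (λ j → ⟦ x (i , j) ^ₘ e i ⟧ v))))))) ⟩
  ∑-pairs factorizations m (λ u v → ∑ℚ divisors λ i → ℕ→ℚ (suc i) ℚ.* ∑ℚ (upTo (width m)) λ j → H l u ℚ.* ⟦ x (i , j) ^ₘ e i ⟧ v)
    ≡⟨ ∑ℚ-swap (factorizations m) divisors _ ⟩
  ∑ℚ divisors (λ i → ∑-pairs factorizations m λ u v → ℕ→ℚ (suc i) ℚ.* ∑ℚ (upTo (width m)) λ j → H l u ℚ.* ⟦ x (i , j) ^ₘ e i ⟧ v)
    ≡⟨ ∑ℚ-cong divisors (λ i → trans (∑ℚ-*ˡ (factorizations m) (ℕ→ℚ (suc i)) _)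
         (cong (ℕ→ℚ (suc i) ℚ.*_) (∑ℚ-swap (factorizations m) (upTo (width m)) _))) ⟩
  ∑ℚ divisors (λ i → ℕ→ℚ (suc i) ℚ.* ∑ℚ (upTo (width m)) λ j → (H l ⊛ ⟦ x (i , j) ^ₘ e i ⟧) m)
    -- Divisibility turns `suc i * e i` into `suc k`, which frees the indicator from `i`.
    ≡⟨ ∑ℚ-cong-All (Allₚ.all-filter (λ i → suc i ∣? suc k) (upTo (suc k))) (λ i i∣k → trans
         (cong (ℕ→ℚ (suc i) ℚ.*_) (trans
           (∑ℚ-cong (upTo (width m)) λ j → trans (H-⊛-power l i j (e i) m)
              (cong (λ d → 𝟏 (degree m ≟ l + d) ℚ.* 𝟏 (e i ≤? exponent m i j)) (m*[n/m]≡n i∣k)))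
           (∑ℚ-*ˡ (upTo (width m)) δ λ j → 𝟏 (e i ≤? exponent m i j))))
         (*-swapˡ (ℕ→ℚ (suc i)) δ _)) ⟩
  ∑ℚ divisors (λ i → δ ℚ.* (ℕ→ℚ (suc i) ℚ.* ∑ℚ (upTo (width m)) (λ j → 𝟏 (e i ≤? exponent m i j))))
    ≡⟨ ∑ℚ-*ˡ divisors δ _ ⟩
  δ ℚ.* ∑ℚ divisors (λ i → ℕ→ℚ (suc i) ℚ.* ∑ℚ (upTo (width m)) (λ j → 𝟏 (e i ≤? exponent m i j))) ∎
  where
  open ≡-Reasoning
  divisors = filter (λ i → suc i ∣? suc k) (upTo (suc k))
  e : ℕ → ℕ
  e i = suc k / suc i
  δ = 𝟏 (degree m ≟ l + suc k)

-- Each x_{ij} is counted with weight i once for every e ≤ m_{ij}: the total is deg m.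
Newton-identity : ∀ n m → ∑-pairs splits n (λ k l → (H l ⊛ P (suc k)) m) ≡ ℕ→ℚ (suc n) ℚ.* H (suc n) m
Newton-identity n m = begin
  ∑-pairs splits n (λ k l → (H l ⊛ P (suc k)) m)
    ≡⟨ ∑ℚ-cong-All (splits-Sums-to n) (λ (k , l) eq → trans (H-⊛-P l k m)
         (cong (λ d → 𝟏 (degree m ≟ d) ℚ.* total k) (trans (ℕ.+-suc l k) (cong suc (trans (ℕ.+-comm l k) eq))))) ⟩
  ∑-pairs splits n (λ k _ → H (suc n) m ℚ.* total k)
    ≡⟨ ∑-splits n (λ k _ → H (suc n) m ℚ.* total k) ⟩
  ∑ℚ (upTo (suc n)) (λ k → H (suc n) m ℚ.* total k)
    ≡⟨ ∑ℚ-*ˡ (upTo (suc n)) (H (suc n) m) total ⟩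
  H (suc n) m ℚ.* ∑ℚ (upTo (suc n)) total
    -- Off degree `suc n` both sides vanish, so the count is only required for `degree m ≡ suc n`.
    ≡⟨ 𝟏-*-cong (degree m ≟ suc n) (λ deg → trans (∑-total deg) (cong ℕ→ℚ deg)) ⟩
  H (suc n) m ℚ.* ℕ→ℚ (suc n)
    ≡⟨ ℚ.*-comm (H (suc n) m) (ℕ→ℚ (suc n)) ⟩
  ℕ→ℚ (suc n) ℚ.* H (suc n) m ∎
  where
  open ≡-Reasoning
  W = width m
  -- Long enough both for every divisor of a number up to `suc n` and for every row of `m`.
  I = suc n + length m
  count : ℕ → ℕ → ℚ
  count k i = ∑ℚ (upTo W) (λ j → 𝟏 (suc k / suc i ≤? exponent m i j))
  total : ℕ → ℚ
  total k = ∑ℚ (filter (λ i → suc i ∣? suc k) (upTo (suc k))) (λ i → ℕ→ℚ (suc i) ℚ.* count k i)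
  term : ℕ → ℕ → ℚ
  term k i = 𝟏 (suc i ∣? suc k) ℚ.* (ℕ→ℚ (suc i) ℚ.* count k i)
  term-beyond : ∀ k i → suc k ≤ i → term k i ≡ 0ℚ
  term-beyond k i k<i = trans
    (cong (ℚ._* (ℕ→ℚ (suc i) ℚ.* count k i))
      (𝟏-no (suc i ∣? suc k) λ i∣k → ℕ.<⇒≱ k<i (ℕ.≤-pred (∣⇒≤ i∣k))))
    (ℚ.*-zeroˡ (ℕ→ℚ (suc i) ℚ.* count k i))
  total-extend : ∀ k → k ≤ n → total k ≡ ∑ℚ (upTo I) (term k)
  total-extend k k≤n = trans (∑ℚ-filter (λ i → suc i ∣? suc k) (upTo (suc k)) _)
    (sym (∑ℚ-upTo-extend (ℕ.≤-trans (s≤s k≤n) (ℕ.m≤m+n (suc n) (length m))) (term k) (term-beyond k)))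
  term-× : ∀ k i → term k i ≡
    ℕ→ℚ (suc i) ℚ.* ∑ℚ (upTo W) (λ j → 𝟏 (suc i ∣? suc k ×-dec suc k / suc i ≤? exponent m i j))
  term-× k i = trans (*-swapˡ (𝟏 (suc i ∣? suc k)) (ℕ→ℚ (suc i)) (count k i)) (cong (ℕ→ℚ (suc i) ℚ.*_) (trans
    (sym (∑ℚ-*ˡ (upTo W) (𝟏 (suc i ∣? suc k)) λ j → 𝟏 (suc k / suc i ≤? exponent m i j)))
    (∑ℚ-cong (upTo W) λ j → sym (𝟏-× (suc i ∣? suc k) (suc k / suc i ≤? exponent m i j)))))
  ∑-total : degree m ≡ suc n → ∑ℚ (upTo (suc n)) total ≡ ℕ→ℚ (degree m)
  ∑-total deg = begin
    ∑ℚ (upTo (suc n)) total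
      ≡⟨ ∑ℚ-cong-All (All.tabulate {xs = upTo (suc n)} ∈-upTo⁻) (λ k k<sn → trans
           (total-extend k (ℕ.≤-pred k<sn)) (∑ℚ-cong (upTo I) (term-× k))) ⟩
    ∑ℚ (upTo (suc n)) (λ k → ∑ℚ (upTo I) λ i → ℕ→ℚ (suc i) ℚ.* ∑ℚ (upTo W) (hit k i))
      ≡⟨ ∑ℚ-swap (upTo (suc n)) (upTo I) (λ k i → ℕ→ℚ (suc i) ℚ.* ∑ℚ (upTo W) (hit k i)) ⟩
    ∑ℚ (upTo I) (λ i → ∑ℚ (upTo (suc n)) λ k → ℕ→ℚ (suc i) ℚ.* ∑ℚ (upTo W) (hit k i))
      ≡⟨ ∑ℚ-cong (upTo I) (λ i → trans (∑ℚ-*ˡ (upTo (suc n)) (ℕ→ℚ (suc i)) (λ k → ∑ℚ (upTo W) (hit k i)))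
           (cong (ℕ→ℚ (suc i) ℚ.*_) (trans (∑ℚ-swap (upTo (suc n)) (upTo W) (λ k → hit k i))
             (∑ℚ-cong (upTo W) λ j → count-multiples i (exponent m i j)
               (subst (suc i * exponent m i j ≤_) deg (exponent≤degree m i j)))))) ⟩
    ∑ℚ (upTo I) (λ i → ℕ→ℚ (suc i) ℚ.* ∑ℚ (upTo W) (λ j → ℕ→ℚ (exponent m i j)))
      ≡⟨ ℕ→ℚ-degree m (ℕ.m≤n+m (length m) (suc n)) ⟨
    ℕ→ℚ (degree m) ∎
    where
    hit : ℕ → ℕ → ℕ → ℚ
    hit k i j = 𝟏 (suc i ∣? suc k ×-dec suc k / suc i ≤? exponent m i j)

-- Sums over compositions

[x^1] : ∀ F → F [x^ 1 ] ≈ F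
[x^1] F m rewrite dec-true (all? (all? (1 ∣?_)) m) (All.universal (All.universal 1∣_) m) =
  cong F (trans (List.map-cong (λ r → trans (List.map-cong n/1≡n r) (List.map-id r)) m) (List.map-id m))

-- Summands see only the list of parts, so a part can be appended without a positivity proof.
∑-compositions : ℕ → (List ℕ → ℚ) → ℚ
∑-compositions n f = ∑ℚ (compositions n) (f ∘ parts)

∑-compositions-cong : ∀ n {f g} → (∀ α → sum α ≡ n → f α ≡ g α) → ∑-compositions n f ≡ ∑-compositions n g
∑-compositions-cong n h = ∑ℚ-cong-All (All.tabulate (compositions-sound n)) λ α → h (parts α)

grow-parts : List ℕ → List (List ℕ)
grow-parts []      = [ [ 1 ] ]
grow-parts (a ∷ α) = (1 ∷ a ∷ α) ∷ (suc a ∷ α) ∷ []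

∑-compositions-suc : ∀ n f → ∑-compositions (suc n) f ≡ ∑-compositions n (λ α → ∑ℚ (grow-parts α) f)
∑-compositions-suc n f = trans (∑ℚ-concatMap (compositions n) grow (f ∘ parts))
  (∑ℚ-cong (compositions n) λ { (comp [] _) → refl ; (comp (_ ∷ _) _) → refl })

∑-splits-only-last : ∀ n h → (∀ k l → h k (suc l) ≡ 0ℚ) → ∑-pairs splits n h ≡ h n 0
∑-splits-only-last zero    h z = ℚ.+-identityʳ (h 0 0)
∑-splits-only-last (suc n) h z = trans (∑-splits-last n h)
  (trans (cong (ℚ._+ h (suc n) 0) (trans (∑-pairs-cong splits n z) (∑ℚ-zero (splits n))))
         (ℚ.+-identityˡ (h (suc n) 0)))

-- The enumeration grows compositions at the front, while the recursion for
-- 1/Z splits off the last part.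
∑-compositions-∷ʳ : ∀ n f → ∑-compositions (suc n) f ≡
  ∑-pairs splits n (λ k l → ∑-compositions l (λ α → f (α ∷ʳ suc k)))
∑-compositions-∷ʳ zero    f = sym (ℚ.+-identityʳ (f [ 1 ] ℚ.+ 0ℚ))
∑-compositions-∷ʳ (suc n) f = begin
  ∑-compositions (suc (suc n)) f
    ≡⟨ ∑-compositions-suc (suc n) f ⟩
  ∑-compositions (suc n) (λ α → ∑ℚ (grow-parts α) f)
    ≡⟨ ∑-compositions-∷ʳ n (λ α → ∑ℚ (grow-parts α) f) ⟩
  ∑-pairs splits n (λ k l → ∑-compositions l (λ α → ∑ℚ (grow-parts (α ∷ʳ suc k)) f))
    ≡⟨ ∑-pairs-cong splits n (λ k l → trans (∑ℚ-cong (compositions l) λ α → grow-∷ʳ k (parts α))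
         (trans (∑ℚ-+ (compositions l) (λ α → ∑ℚ (grow-parts (parts α)) (λ β → f (β ∷ʳ suc k))) (only-[] k ∘ parts))
                (cong (ℚ._+ ∑-compositions l (only-[] k)) (sym (∑-compositions-suc l (λ β → f (β ∷ʳ suc k))))))) ⟩
  ∑-pairs splits n (λ k l → h k (suc l) ℚ.+ ∑-compositions l (only-[] k))
    ≡⟨ ∑-pairs-+ splits n (λ k l → h k (suc l)) (λ k l → ∑-compositions l (only-[] k)) ⟩
  ∑-pairs splits n (λ k l → h k (suc l)) ℚ.+ ∑-pairs splits n (λ k l → ∑-compositions l (only-[] k))
    -- The surplus survives only at `l = 0`, `k = n`, where it is the one-part composition:
    -- precisely the missing pair `(suc n , 0)`.
    ≡⟨ cong (∑-pairs splits n (λ k l → h k (suc l)) ℚ.+_)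
         (∑-splits-only-last n (λ k l → ∑-compositions l (only-[] k)) λ k l →
           trans (∑-compositions-cong (suc l) (nonempty k)) (∑ℚ-zero (compositions (suc l)))) ⟩
  ∑-pairs splits n (λ k l → h k (suc l)) ℚ.+ h (suc n) 0
    ≡⟨ ∑-splits-last n h ⟨
  ∑-pairs splits (suc n) h ∎
  where
  open ≡-Reasoning
  h : ℕ → ℕ → ℚ
  h k l = ∑-compositions l (λ α → f (α ∷ʳ suc k))
  -- Growing at the front commutes with appending a last part except at the empty list, where the
  -- appended part is also the first and can itself be increased.
  only-[] : ℕ → List ℕ → ℚ
  only-[] k []      = f [ suc (suc k) ]
  only-[] k (_ ∷ _) = 0ℚ
  grow-∷ʳ : ∀ k α → ∑ℚ (grow-parts (α ∷ʳ suc k)) f ≡ ∑ℚ (grow-parts α) (λ β → f (β ∷ʳ suc k)) ℚ.+ only-[] k α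
  grow-∷ʳ k []      = cong₂ ℚ._+_ (sym (ℚ.+-identityʳ (f (1 ∷ suc k ∷ [])))) (ℚ.+-identityʳ (f [ suc (suc k) ]))
  grow-∷ʳ k (a ∷ α) = sym (ℚ.+-identityʳ (∑ℚ (grow-parts (a ∷ α ∷ʳ suc k)) f))
  nonempty : ∀ k {l} α → sum α ≡ suc l → only-[] k α ≡ 0ℚ
  nonempty k (_ ∷ _) _ = refl

partial-sum-product-∷ʳ : ∀ s α a → partial-sum-product s (α ∷ʳ a) ≡ partial-sum-product s α * (s + sum α + a)
partial-sum-product-∷ʳ s []      a = trans (ℕ.*-comm (s + a) 1) (cong (λ k → 1 * (k + a)) (sym (ℕ.+-identityʳ s)))
partial-sum-product-∷ʳ s (b ∷ α) a = trans
  (cong ((s + b) *_) (trans (partial-sum-product-∷ʳ (s + b) α a)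
    (cong (λ k → partial-sum-product (s + b) α * (k + a)) (ℕ.+-assoc s b (sum α)))))
  (sym (ℕ.*-assoc (s + b) (partial-sum-product (s + b) α) _))

-- The product over the parts with `F` in place of the innermost unit; appending a part then just
-- multiplies `F` on the left.
P[x^1]-product : Series → List ℕ → Series
P[x^1]-product F α = foldr _⊛_ F (map (λ d → P d [x^ 1 ]) α)

P[x^1]-product-∷ʳ : ∀ F α a → P[x^1]-product F (α ∷ʳ a) ≡ P[x^1]-product (P a [x^ 1 ] ⊛ F) α
P[x^1]-product-∷ʳ F []      a = refl
P[x^1]-product-∷ʳ F (b ∷ α) a = cong (P b [x^ 1 ] ⊛_) (P[x^1]-product-∷ʳ F α a)

P[x^1]-product-⊛ : ∀ F G α → P[x^1]-product F α ⊛ G ≈ P[x^1]-product (F ⊛ G) α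
P[x^1]-product-⊛ F G []      m = refl
P[x^1]-product-⊛ F G (a ∷ α) m = trans
  (sym (⊛-assoc (P a [x^ 1 ]) (P[x^1]-product F α) G m))
  (⊛-congˡ (P a [x^ 1 ]) (P[x^1]-product-⊛ F G α) m)

-- The extra factor F makes the induction on the last part go through: that
-- part is absorbed into F.
∑-P/Z : ∀ {N} n → n ≤ N → ∀ F m →
  ∑-compositions n (λ α → P[x^1]-product F α m ℚ.* recip (partial-sum-product 0 α)) ≡ (H n ⊛ F) m
∑-P/Z zero _ F m = trans (ℚ.+-identityʳ (F m ℚ.* 1ℚ)) (trans (ℚ.*-identityʳ (F m))
  (sym (trans (⊛-congʳ F H₀≈𝟙 m) (⊛-identityˡ F m))))
∑-P/Z (suc n) (s≤s n≤N) F m = begin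
  ∑-compositions (suc n) (summand F)
    ≡⟨ ∑-compositions-∷ʳ n (summand F) ⟩
  ∑-pairs splits n (λ k l → ∑-compositions l (λ α → summand F (α ∷ʳ suc k)))
    ≡⟨ ∑ℚ-cong-All (splits-Sums-to n) (λ (k , l) k+l≡n → trans
         (∑-compositions-cong l (summand-∷ʳ k+l≡n))
         (trans (∑ℚ-*ʳ (compositions l) (recip (suc n)) (summand (P (suc k) [x^ 1 ] ⊛ F) ∘ parts))
         (cong (ℚ._* recip (suc n)) (trans
           -- Strong induction: `l` is any number up to `n`, and the bound `N` is what decreases.
           (∑-P/Z l (ℕ.≤-trans (ℕ.m+n≤o⇒n≤o k (ℕ.≤-reflexive k+l≡n)) n≤N) (P (suc k) [x^ 1 ] ⊛ F) m)
           (trans (⊛-congˡ (H l) (⊛-congʳ F ([x^1] (P (suc k)))) m)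
                  (⊛-assoc (H l) (P (suc k)) F m)))))) ⟩
  ∑-pairs splits n (λ k l → ((H l ⊛ P (suc k)) ⊛ F) m ℚ.* recip (suc n))
    ≡⟨ ∑ℚ-*ʳ (splits n) (recip (suc n)) (λ (k , l) → ((H l ⊛ P (suc k)) ⊛ F) m) ⟩
  ∑-pairs splits n (λ k l → ((H l ⊛ P (suc k)) ⊛ F) m) ℚ.* recip (suc n)
    ≡⟨ cong (ℚ._* recip (suc n)) (trans
         -- With the factorization fixed first, the recursion for `H` applies at the first factor
         -- `u`.
         (∑ℚ-swap (splits n) (factorizations m) (λ (k , l) (u , v) → (H l ⊛ P (suc k)) u ℚ.* F v))
         (∑-pairs-cong factorizations m λ u v → trans
           (∑ℚ-*ʳ (splits n) (F v) (λ (k , l) → (H l ⊛ P (suc k)) u))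
           (trans (cong (ℚ._* F v) (Newton-identity n u)) (ℚ.*-assoc (ℕ→ℚ (suc n)) (H (suc n) u) (F v))))) ⟩
  ∑-pairs factorizations m (λ u v → ℕ→ℚ (suc n) ℚ.* (H (suc n) u ℚ.* F v)) ℚ.* recip (suc n)
    ≡⟨ cong (ℚ._* recip (suc n)) (∑ℚ-*ˡ (factorizations m) (ℕ→ℚ (suc n)) (λ (u , v) → H (suc n) u ℚ.* F v)) ⟩
  (ℕ→ℚ (suc n) ℚ.* (H (suc n) ⊛ F) m) ℚ.* recip (suc n)
    ≡⟨ trans (ℚ.*-comm _ (recip (suc n))) (sym (ℚ.*-assoc (recip (suc n)) (ℕ→ℚ (suc n)) _)) ⟩
  (recip (suc n) ℚ.* ℕ→ℚ (suc n)) ℚ.* (H (suc n) ⊛ F) m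
    ≡⟨ trans (cong (ℚ._* (H (suc n) ⊛ F) m) (recip-inverse n)) (ℚ.*-identityˡ _) ⟩
  (H (suc n) ⊛ F) m ∎
  where
  open ≡-Reasoning
  summand : Series → List ℕ → ℚ
  summand F α = P[x^1]-product F α m ℚ.* recip (partial-sum-product 0 α)
  summand-∷ʳ : ∀ {k l} → k + l ≡ n → ∀ α → sum α ≡ l →
               summand F (α ∷ʳ suc k) ≡ summand (P (suc k) [x^ 1 ] ⊛ F) α ℚ.* recip (suc n)
  summand-∷ʳ {k} refl α refl = trans
    (cong₂ ℚ._*_ (cong (λ G → G m) (P[x^1]-product-∷ʳ F α (suc k)))
      (trans (cong recip (trans (partial-sum-product-∷ʳ 0 α (suc k))
                                (cong (partial-sum-product 0 α *_) (ℕ.+-comm (sum α) (suc k)))))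
             (recip-* (partial-sum-product 0 α) (suc (k + sum α)))))
    (sym (ℚ.*-assoc (P[x^1]-product (P (suc k) [x^ 1 ] ⊛ F) α m) _ _))

proposition18 : (d : ℕ) → H d ≈ ∑ (PCom-sqf d) (λ δ → (P⟨ proj₁ δ ⟩ ÷ Z δ) {{Z≢0 δ}})
proposition18 d m = sym (begin
  ∑ (PCom-sqf d) (λ δ → (P⟨ proj₁ δ ⟩ ÷ Z δ) {{Z≢0 δ}}) m
    ≡⟨ ∑ℚ-map (compositions d) (λ α → α ¹ , α , refl) (λ δ → (P⟨ proj₁ δ ⟩ ÷ Z δ) {{Z≢0 δ}} m) ⟩
  ∑ℚ (compositions d) (λ α → (P⟨ α ¹ ⟩ ÷ Zᶜ α) {{Z≢0 (α ¹ , α , refl)}} m)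
    -- Two units occur: one closes `∏`, the other is the product over the empty rest of the
    -- polycomposition.
    ≡⟨ ∑ℚ-cong (compositions d) (λ α → cong₂ ℚ._*_ (P[x^1]-product-⊛ 𝟙 𝟙 (parts α) m)
         (recip-NonZero (Zᶜ α) {{Z≢0 (α ¹ , α , refl)}})) ⟩
  ∑-compositions d (λ α → P[x^1]-product (𝟙 ⊛ 𝟙) α m ℚ.* recip (partial-sum-product 0 α))
    ≡⟨ ∑-P/Z d ℕ.≤-refl (𝟙 ⊛ 𝟙) m ⟩
  (H d ⊛ (𝟙 ⊛ 𝟙)) m
    ≡⟨ ⊛-congˡ (H d) (⊛-identityˡ 𝟙) m ⟩
  (H d ⊛ 𝟙) m
    ≡⟨ H-⊛-𝟙 d m ⟩
  H d m ∎)
  where open ≡-Reasoning
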